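{- There are absolute constants $K,c>0$ such that for every sufficiently large $n\in\mathbb N$ there is a function $f:\{0,1\}^{n^2}\to\{0,1\}$ with $\mathrm{EC}(f)\le K n$ and $C(f)\ge c\,n^2$. In particular, $C(f)=\Omega(\mathrm{EC}(f)^2)$ for this family of functions.
   Context: Let $f:\{0,1\}^N\to\{0,1\}$ and $[N]=\{1,\dots,N\}$. Certificate complexity: an assignment is a map $A:[N]\to\{0,1,*\}$, identified with the subcube $\{x: \forall i,\ x_i=A(i)\text{ or }A(i)=*\}$; its size is $|A|=|\{i:A(i)\ne *\}|$. A $b$-certificate for $f$ is an assignment $A$ such that $x\in A\Rightarrow f(x)=b$. $C(f,x)$ is the size of the smallest $f(x)$-certificate consistent with $x$ (i.e. with $x\in A$), and $C(f)=\max_x C(f,x)$. The expectational certificate complexity $\mathrm{EC}(f)$ is the optimal value of the following program over families $\{w_x\}_{x\in\{0,1\}^N}$, $w_x\in\mathbb R^N$: minimize $\max_{x}\sum_{i=1}^N w_x(i)$ subject to $\sum_{i:x_i\ne y_i} w_x(i)w_y(i)\ge 1$ for all $x,y$ with $f(x)\ne f(y)$, and $0\le w_x(i)\le 1$ for all $x\in\{0,1\}^N$, $i\in[N]$. -}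

module Defs where

open import Algebra.Bundles using (AbelianGroup)
import Algebra.Properties.AbelianGroup as AbelianGroupProperties
import Algebra.Properties.CommutativeSemigroup as CommutativeSemigroupProperties
import Algebra.Properties.Group as GroupProperties
open import Data.Bool as Bool using (Bool; true; false; if_then_else_)
open import Data.Fin using (Fin)
import Data.Fin.Properties as Fin
open import Data.Integer as ℤ using ()
open import Data.List using (List; []; _∷_; map; filter; cartesianProductWith)
open import Data.List.Extrema.Nat using (min; max)
open import Data.Maybe using (Maybe; just; nothing; is-just)
import Data.Maybe.Properties as Maybe
open import Data.Nat as ℕ using (ℕ; zero; suc)
import Data.Nat.Properties as ℕ
open import Data.Product using (∃-syntax; _×_; _,_)
open import Data.Rational as ℚ using (ℚ; 0ℚ; 1ℚ; ½)
import Data.Rational.Properties as ℚ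
open import Data.Sum using (_⊎_; inj₁; inj₂)
open import Data.Vec using (Vec; []; _∷_; lookup)
import Data.Vec as Vec
import Data.Vec.Functional as Vector
open import Function using (_∘_)
open import Relation.Binary.PropositionalEquality
  using (_≡_; _≢_; refl; sym; trans; cong; cong₂; subst; module ≡-Reasoning)
open import Relation.Nullary using (Dec)
open import Relation.Nullary.Decidable using (_⊎-dec_; _×-dec_; _→-dec_; map′; T?; ⌊_⌋)

private
  open AbelianGroupProperties ℚ.+-0-abelianGroup using (xyx⁻¹≈y; ⁻¹-anti-homo‿-)
  open GroupProperties ℚ.+-0-group using (//-rightDividesˡ)
  open CommutativeSemigroupProperties
    (AbelianGroup.commutativeSemigroup ℚ.+-0-abelianGroup) using (interchange)

  p≡[p-q]+q : ∀ p q → p ≡ p ℚ.- q ℚ.+ q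
  p≡[p-q]+q p q = sym (//-rightDividesˡ q p)

  [a+b]-[c+d]≡[a-c]+[b-d] : ∀ a b c d →
    a ℚ.+ b ℚ.- (c ℚ.+ d) ≡ (a ℚ.- c) ℚ.+ (b ℚ.- d)
  [a+b]-[c+d]≡[a-c]+[b-d] a b c d = trans
    (cong (a ℚ.+ b ℚ.+_) (ℚ.neg-distrib-+ c d))
    (interchange a b (ℚ.- c) (ℚ.- d))

  ab-cd≡a[b-d]+d[a-c] : ∀ a b c d →
    a ℚ.* b ℚ.- c ℚ.* d ≡ a ℚ.* (b ℚ.- d) ℚ.+ d ℚ.* (a ℚ.- c)
  ab-cd≡a[b-d]+d[a-c] a b c d = begin
    a ℚ.* b ℚ.- c ℚ.* d
      ≡⟨ cong (ℚ._- c ℚ.* d) (p≡[p-q]+q (a ℚ.* b) (a ℚ.* d)) ⟩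
    a ℚ.* b ℚ.- a ℚ.* d ℚ.+ a ℚ.* d ℚ.- c ℚ.* d
      ≡⟨ ℚ.+-assoc (a ℚ.* b ℚ.- a ℚ.* d) (a ℚ.* d) (ℚ.- (c ℚ.* d)) ⟩
    (a ℚ.* b ℚ.- a ℚ.* d) ℚ.+ (a ℚ.* d ℚ.- c ℚ.* d)
      ≡⟨ cong₂ ℚ._+_ (distrib a b d)
           (trans (cong₂ ℚ._-_ (ℚ.*-comm a d) (ℚ.*-comm c d)) (distrib d a c)) ⟩
    a ℚ.* (b ℚ.- d) ℚ.+ d ℚ.* (a ℚ.- c) ∎
    where
    open ≡-Reasoning
    distrib : ∀ p q r → p ℚ.* q ℚ.- p ℚ.* r ≡ p ℚ.* (q ℚ.- r)
    distrib p q r = sym (trans (ℚ.*-distribˡ-+ p q (ℚ.- r))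
      (cong (p ℚ.* q ℚ.+_) (sym (ℚ.neg-distribʳ-* p r))))

  ∣-∣⇒≤ : ∀ p q {ε} → ℚ.∣ p ℚ.- q ∣ ℚ.≤ ε → p ℚ.≤ q ℚ.+ ε
  ∣-∣⇒≤ p q {ε} h = begin
    p                        ≡⟨ p≡[p-q]+q p q ⟩
    p ℚ.- q ℚ.+ q            ≡⟨ ℚ.+-comm (p ℚ.- q) q ⟩
    q ℚ.+ (p ℚ.- q)          ≤⟨ ℚ.+-monoʳ-≤ q (p≤∣p∣ (p ℚ.- q)) ⟩
    q ℚ.+ ℚ.∣ p ℚ.- q ∣      ≤⟨ ℚ.+-monoʳ-≤ q h ⟩
    q ℚ.+ ε                  ∎
    where
    open ℚ.≤-Reasoning
    p≤∣p∣ : ∀ p → p ℚ.≤ ℚ.∣ p ∣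
    p≤∣p∣ p with ℚ.≤-total 0ℚ p
    ... | inj₁ 0≤p = ℚ.≤-reflexive (sym (ℚ.0≤p⇒∣p∣≡p 0≤p))
    ... | inj₂ p≤0 = ℚ.≤-trans p≤0 (ℚ.0≤∣p∣ p)

  ≤⇒∣-∣ : ∀ p q {ε} → p ℚ.≤ q ℚ.+ ε → q ℚ.≤ p ℚ.+ ε → ℚ.∣ p ℚ.- q ∣ ℚ.≤ ε
  ≤⇒∣-∣ p q {ε} h k with ℚ.∣p∣≡p∨∣p∣≡-p (p ℚ.- q)
  ... | inj₁ e = begin
    ℚ.∣ p ℚ.- q ∣            ≡⟨ e ⟩
    p ℚ.- q                  ≤⟨ ℚ.+-monoˡ-≤ (ℚ.- q) h ⟩
    q ℚ.+ ε ℚ.- q            ≡⟨ xyx⁻¹≈y q ε ⟩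
    ε                        ∎
    where open ℚ.≤-Reasoning
  ... | inj₂ e = begin
    ℚ.∣ p ℚ.- q ∣            ≡⟨ e ⟩
    ℚ.- (p ℚ.- q)            ≡⟨ ⁻¹-anti-homo‿- p q ⟩
    q ℚ.- p                  ≤⟨ ℚ.+-monoˡ-≤ (ℚ.- p) k ⟩
    p ℚ.+ ε ℚ.- p            ≡⟨ xyx⁻¹≈y p ε ⟩
    ε                        ∎
    where open ℚ.≤-Reasoning

  half-pos : ∀ {ε} → 0ℚ ℚ.< ε → 0ℚ ℚ.< ½ ℚ.* ε
  half-pos {ε} h = ℚ.positive⁻¹ (½ ℚ.* ε) {{ℚ.pos*pos⇒pos ½ ε {{ℚ.positive h}}}}

  half+half : ∀ ε → ½ ℚ.* ε ℚ.+ ½ ℚ.* ε ≡ ε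
  half+half ε = trans (sym (ℚ.*-distribʳ-+ ε ½ ½)) (ℚ.*-identityˡ ε)

-- Real numbers: Cauchy sequences of rationals.  Equality of reals is
-- x ≤ y × y ≤ x, never propositional equality of sequences.
Cauchy : (ℕ → ℚ) → Set
Cauchy s = ∀ ε → 0ℚ ℚ.< ε →
  ∃[ N ] (∀ m n → N ℕ.≤ m → N ℕ.≤ n → ℚ.∣ s m ℚ.- s n ∣ ℚ.≤ ε)

record ℝ : Set where
  constructor mkℝ
  field
    seq    : ℕ → ℚ
    cauchy : Cauchy seq

open ℝ public

infix  4 _≤_ _<_
infixl 6 _+_ _⊔_
infixl 7 _*_

_≤_ : ℝ → ℝ → Set
x ≤ y = ∀ ε → 0ℚ ℚ.< ε → ∃[ N ] (∀ n → N ℕ.≤ n → seq x n ℚ.≤ seq y n ℚ.+ ε)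

_<_ : ℝ → ℝ → Set
x < y = ∃[ ε ] (0ℚ ℚ.< ε × ∃[ N ] (∀ n → N ℕ.≤ n → seq x n ℚ.+ ε ℚ.≤ seq y n))

private
  abstract
    const-cauchy : ∀ q → Cauchy (λ _ → q)
    const-cauchy q ε 0<ε = 0 , λ _ _ _ _ →
      subst (ℚ._≤ ε) (sym (cong ℚ.∣_∣ (ℚ.+-inverseʳ q))) (ℚ.<⇒≤ 0<ε)

fromℚ : ℚ → ℝ
fromℚ q = mkℝ (λ _ → q) (const-cauchy q)

fromℕ : ℕ → ℝ
fromℕ n = fromℚ (ℤ.+ n ℚ./ 1)

0ℝ 1ℝ : ℝ
0ℝ = fromℕ 0
1ℝ = fromℕ 1

private
  abstract
    +-cauchy : ∀ x y → Cauchy (λ n → seq x n ℚ.+ seq y n)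
    +-cauchy x y ε 0<ε with cauchy x (½ ℚ.* ε) (half-pos 0<ε) | cauchy y (½ ℚ.* ε) (half-pos 0<ε)
    ... | M , hx | N , hy = M ℕ.⊔ N , λ m n p q → begin
      ℚ.∣ seq x m ℚ.+ seq y m ℚ.- (seq x n ℚ.+ seq y n) ∣
        ≡⟨ cong ℚ.∣_∣ ([a+b]-[c+d]≡[a-c]+[b-d] (seq x m) (seq y m) (seq x n) (seq y n)) ⟩
      ℚ.∣ (seq x m ℚ.- seq x n) ℚ.+ (seq y m ℚ.- seq y n) ∣
        ≤⟨ ℚ.∣p+q∣≤∣p∣+∣q∣ (seq x m ℚ.- seq x n) (seq y m ℚ.- seq y n) ⟩
      ℚ.∣ seq x m ℚ.- seq x n ∣ ℚ.+ ℚ.∣ seq y m ℚ.- seq y n ∣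
        ≤⟨ ℚ.+-mono-≤ (hx m n (ℕ.m⊔n≤o⇒m≤o M N p) (ℕ.m⊔n≤o⇒m≤o M N q))
                      (hy m n (ℕ.m⊔n≤o⇒n≤o M N p) (ℕ.m⊔n≤o⇒n≤o M N q)) ⟩
      ½ ℚ.* ε ℚ.+ ½ ℚ.* ε
        ≡⟨ half+half ε ⟩
      ε ∎
      where open ℚ.≤-Reasoning

_+_ : ℝ → ℝ → ℝ
x + y = mkℝ (λ n → seq x n ℚ.+ seq y n) (+-cauchy x y)

private
  ⊔-≤ : ∀ a b c d {ε} → a ℚ.≤ c ℚ.+ ε → b ℚ.≤ d ℚ.+ ε → a ℚ.⊔ b ℚ.≤ (c ℚ.⊔ d) ℚ.+ ε
  ⊔-≤ a b c d {ε} h k = ℚ.⊔-lub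
    (ℚ.≤-trans h (ℚ.+-monoˡ-≤ ε (ℚ.p≤p⊔q c d)))
    (ℚ.≤-trans k (ℚ.+-monoˡ-≤ ε (ℚ.p≤q⊔p c d)))

private
  abstract
    ⊔-cauchy : ∀ x y → Cauchy (λ n → seq x n ℚ.⊔ seq y n)
    ⊔-cauchy x y ε 0<ε with cauchy x ε 0<ε | cauchy y ε 0<ε
    ... | M , hx | N , hy = M ℕ.⊔ N , λ m n p q →
      ≤⇒∣-∣ (seq x m ℚ.⊔ seq y m) (seq x n ℚ.⊔ seq y n) (below m n p q) (below n m q p)
      where
      below : ∀ m n → M ℕ.⊔ N ℕ.≤ m → M ℕ.⊔ N ℕ.≤ n →
              seq x m ℚ.⊔ seq y m ℚ.≤ (seq x n ℚ.⊔ seq y n) ℚ.+ ε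
      below m n p q = ⊔-≤ (seq x m) (seq y m) (seq x n) (seq y n)
        (∣-∣⇒≤ (seq x m) (seq x n) (hx m n (ℕ.m⊔n≤o⇒m≤o M N p) (ℕ.m⊔n≤o⇒m≤o M N q)))
        (∣-∣⇒≤ (seq y m) (seq y n) (hy m n (ℕ.m⊔n≤o⇒n≤o M N p) (ℕ.m⊔n≤o⇒n≤o M N q)))

_⊔_ : ℝ → ℝ → ℝ
x ⊔ y = mkℝ (λ n → seq x n ℚ.⊔ seq y n) (⊔-cauchy x y)

private
  -- An eventual bound, positive so that it can be divided by.
  bound : ∀ x → ∃[ B ] (0ℚ ℚ.< B × ∃[ N ] (∀ n → N ℕ.≤ n → ℚ.∣ seq x n ∣ ℚ.≤ B))
  bound x with cauchy x 1ℚ (ℚ.positive⁻¹ 1ℚ)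
  ... | N , h = 1ℚ ℚ.+ ℚ.∣ seq x N ∣
              , ℚ.+-mono-<-≤ (ℚ.positive⁻¹ 1ℚ) (ℚ.0≤∣p∣ (seq x N))
              , N , λ n p → begin
    ℚ.∣ seq x n ∣
      ≡⟨ cong ℚ.∣_∣ (p≡[p-q]+q (seq x n) (seq x N)) ⟩
    ℚ.∣ (seq x n ℚ.- seq x N) ℚ.+ seq x N ∣
      ≤⟨ ℚ.∣p+q∣≤∣p∣+∣q∣ (seq x n ℚ.- seq x N) (seq x N) ⟩
    ℚ.∣ seq x n ℚ.- seq x N ∣ ℚ.+ ℚ.∣ seq x N ∣
      ≤⟨ ℚ.+-monoˡ-≤ ℚ.∣ seq x N ∣ (h n N p ℕ.≤-refl) ⟩
    1ℚ ℚ.+ ℚ.∣ seq x N ∣ ∎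
    where open ℚ.≤-Reasoning

  -- For B > 0 there is δ > 0 with B * δ ≡ ½ * ε.
  scale : ∀ {B ε} → 0ℚ ℚ.< B → 0ℚ ℚ.< ε → ∃[ δ ] (0ℚ ℚ.< δ × B ℚ.* δ ≡ ½ ℚ.* ε)
  scale {B} {ε} 0<B 0<ε = δ , 0<δ , eq
    where
    instance
      B-pos : ℚ.Positive B
      B-pos = ℚ.positive 0<B
      B-nz : ℚ.NonZero B
      B-nz = ℚ.pos⇒nonZero B
      h-pos : ℚ.Positive (½ ℚ.* ε)
      h-pos = ℚ.positive (half-pos 0<ε)
    δ : ℚ
    δ = (ℚ.1/ B) ℚ.* (½ ℚ.* ε)
    0<δ : 0ℚ ℚ.< δ
    0<δ = ℚ.positive⁻¹ δ
      {{ℚ.pos*pos⇒pos (ℚ.1/ B) {{ℚ.1/pos⇒pos B}} (½ ℚ.* ε)}}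
    eq : B ℚ.* δ ≡ ½ ℚ.* ε
    eq = trans (sym (ℚ.*-assoc B (ℚ.1/ B) (½ ℚ.* ε)))
         (trans (cong (ℚ._* (½ ℚ.* ε)) (ℚ.*-inverseʳ B)) (ℚ.*-identityˡ (½ ℚ.* ε)))

  ∣*∣-mono : ∀ p q {B δ} → ℚ.∣ p ∣ ℚ.≤ B → ℚ.∣ q ∣ ℚ.≤ δ → 0ℚ ℚ.< B →
             ℚ.∣ p ℚ.* q ∣ ℚ.≤ B ℚ.* δ
  ∣*∣-mono p q {B} {δ} h k 0<B = begin
    ℚ.∣ p ℚ.* q ∣         ≡⟨ ℚ.∣p*q∣≡∣p∣*∣q∣ p q ⟩
    ℚ.∣ p ∣ ℚ.* ℚ.∣ q ∣   ≤⟨ ℚ.*-monoʳ-≤-nonNeg ℚ.∣ q ∣ {{ℚ.∣-∣-nonNeg q}} h ⟩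
    B ℚ.* ℚ.∣ q ∣         ≤⟨ ℚ.*-monoˡ-≤-nonNeg B {{ℚ.nonNegative (ℚ.<⇒≤ 0<B)}} k ⟩
    B ℚ.* δ               ∎
    where open ℚ.≤-Reasoning

private
  abstract
    *-cauchy : ∀ x y → Cauchy (λ n → seq x n ℚ.* seq y n)
    *-cauchy x y ε 0<ε with bound x | bound y
    ... | A , 0<A , M₁ , hA | B , 0<B , N₁ , hB with scale 0<A 0<ε | scale 0<B 0<ε
    ... | α , 0<α , Aα | β , 0<β , Bβ with cauchy x β 0<β | cauchy y α 0<α
    ... | M₂ , hx | N₂ , hy = (M₁ ℕ.⊔ N₁) ℕ.⊔ (M₂ ℕ.⊔ N₂) , λ m n p q → begin
      ℚ.∣ seq x m ℚ.* seq y m ℚ.- seq x n ℚ.* seq y n ∣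
        ≡⟨ cong ℚ.∣_∣ (ab-cd≡a[b-d]+d[a-c] (seq x m) (seq y m) (seq x n) (seq y n)) ⟩
      ℚ.∣ seq x m ℚ.* (seq y m ℚ.- seq y n) ℚ.+ seq y n ℚ.* (seq x m ℚ.- seq x n) ∣
        ≤⟨ ℚ.∣p+q∣≤∣p∣+∣q∣ (seq x m ℚ.* (seq y m ℚ.- seq y n)) (seq y n ℚ.* (seq x m ℚ.- seq x n)) ⟩
      ℚ.∣ seq x m ℚ.* (seq y m ℚ.- seq y n) ∣ ℚ.+ ℚ.∣ seq y n ℚ.* (seq x m ℚ.- seq x n) ∣
        ≤⟨ ℚ.+-mono-≤
             (∣*∣-mono (seq x m) (seq y m ℚ.- seq y n) (hA m (≥M₁ p)) (hy m n (≥N₂ p) (≥N₂ q)) 0<A)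
             (∣*∣-mono (seq y n) (seq x m ℚ.- seq x n) (hB n (≥N₁ q)) (hx m n (≥M₂ p) (≥M₂ q)) 0<B) ⟩
      A ℚ.* α ℚ.+ B ℚ.* β
        ≡⟨ cong₂ ℚ._+_ Aα Bβ ⟩
      ½ ℚ.* ε ℚ.+ ½ ℚ.* ε
        ≡⟨ half+half ε ⟩
      ε ∎
      where
      open ℚ.≤-Reasoning
      ≥₁ : ∀ {k} → (M₁ ℕ.⊔ N₁) ℕ.⊔ (M₂ ℕ.⊔ N₂) ℕ.≤ k → M₁ ℕ.⊔ N₁ ℕ.≤ k
      ≥₁ = ℕ.m⊔n≤o⇒m≤o (M₁ ℕ.⊔ N₁) (M₂ ℕ.⊔ N₂)
      ≥₂ : ∀ {k} → (M₁ ℕ.⊔ N₁) ℕ.⊔ (M₂ ℕ.⊔ N₂) ℕ.≤ k → M₂ ℕ.⊔ N₂ ℕ.≤ k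
      ≥₂ = ℕ.m⊔n≤o⇒n≤o (M₁ ℕ.⊔ N₁) (M₂ ℕ.⊔ N₂)
      ≥M₁ : ∀ {k} → (M₁ ℕ.⊔ N₁) ℕ.⊔ (M₂ ℕ.⊔ N₂) ℕ.≤ k → M₁ ℕ.≤ k
      ≥M₁ = ℕ.m⊔n≤o⇒m≤o M₁ N₁ ∘ ≥₁
      ≥N₁ : ∀ {k} → (M₁ ℕ.⊔ N₁) ℕ.⊔ (M₂ ℕ.⊔ N₂) ℕ.≤ k → N₁ ℕ.≤ k
      ≥N₁ = ℕ.m⊔n≤o⇒n≤o M₁ N₁ ∘ ≥₁
      ≥M₂ : ∀ {k} → (M₁ ℕ.⊔ N₁) ℕ.⊔ (M₂ ℕ.⊔ N₂) ℕ.≤ k → M₂ ℕ.≤ k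
      ≥M₂ = ℕ.m⊔n≤o⇒m≤o M₂ N₂ ∘ ≥₂
      ≥N₂ : ∀ {k} → (M₁ ℕ.⊔ N₁) ℕ.⊔ (M₂ ℕ.⊔ N₂) ℕ.≤ k → N₂ ℕ.≤ k
      ≥N₂ = ℕ.m⊔n≤o⇒n≤o M₂ N₂ ∘ ≥₂

_*_ : ℝ → ℝ → ℝ
x * y = mkℝ (λ n → seq x n ℚ.* seq y n) (*-cauchy x y)

∑ : ∀ {N} → (Fin N → ℝ) → ℝ
∑ = Vector.foldr _+_ 0ℝ

Input : ℕ → Set
Input N = Vec Bool N

BoolFun : ℕ → Set
BoolFun N = Input N → Bool

-- nothing plays the role of *.
Assignment : ℕ → Set
Assignment N = Vec (Maybe Bool) N

infix 4 _∈_

_∈_ : ∀ {N} → Input N → Assignment N → Set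
x ∈ A = ∀ i → just (lookup x i) ≡ lookup A i ⊎ lookup A i ≡ nothing

size : ∀ {N} → Assignment N → ℕ
size = Vec.count (T? ∘ is-just)

IsCertificate : ∀ {N} → BoolFun N → Bool → Assignment N → Set
IsCertificate f b A = ∀ x → x ∈ A → f x ≡ b

infix 4 _∈?_

_∈?_ : ∀ {N} (x : Input N) (A : Assignment N) → Dec (x ∈ A)
x ∈? A = Fin.all? λ i →
  (just (lookup x i) ≟ lookup A i) ⊎-dec (lookup A i ≟ nothing)
  where _≟_ = Maybe.≡-dec Bool._≟_

∀-input? : ∀ {N} {P : Input N → Set} → (∀ x → Dec (P x)) → Dec (∀ x → P x)
∀-input? {zero}  P? = map′ (λ { p [] → p }) (λ h → h []) (P? [])
∀-input? {suc N} P? = map′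
  (λ { (p , q) (false ∷ x) → p x ; (p , q) (true ∷ x) → q x })
  (λ h → (λ x → h (false ∷ x)) , (λ x → h (true ∷ x)))
  (∀-input? (P? ∘ (false ∷_)) ×-dec ∀-input? (P? ∘ (true ∷_)))

certificate? : ∀ {N} (f : BoolFun N) b A → Dec (IsCertificate f b A)
certificate? f b A = ∀-input? λ x → (x ∈? A) →-dec (f x Bool.≟ b)

vectors : {X : Set} → List X → ∀ N → List (Vec X N)
vectors xs zero    = [] ∷ []
vectors xs (suc N) = cartesianProductWith _∷_ xs (vectors xs N)

inputs : ∀ N → List (Input N)
inputs = vectors (false ∷ true ∷ [])

assignments : ∀ N → List (Assignment N)
assignments = vectors (nothing ∷ just false ∷ just true ∷ [])

certificatesAt : ∀ {N} → BoolFun N → Input N → List (Assignment N)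
certificatesAt {N} f x =
  filter (λ A → (x ∈? A) ×-dec certificate? f (f x) A) (assignments N)

-- The default value N is harmless: x itself, read as a total assignment, is
-- an f(x)-certificate of size N.
CAt : ∀ {N} → BoolFun N → Input N → ℕ
CAt {N} f x = min N (map size (certificatesAt f x))

C : ∀ {N} → BoolFun N → ℕ
C {N} f = max 0 (map (CAt f) (inputs N))

Weights : ℕ → Set
Weights N = Input N → Fin N → ℝ

separation : ∀ {N} → Weights N → Input N → Input N → ℝ
separation w x y = ∑ λ i →
  if ⌊ lookup x i Bool.≟ lookup y i ⌋ then 0ℝ else w x i * w y i

record Feasible {N} (f : BoolFun N) (w : Weights N) : Set where
  field
    separates : ∀ x y → f x ≢ f y → 1ℝ ≤ separation w x y
    nonneg    : ∀ x i → 0ℝ ≤ w x i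
    ≤one      : ∀ x i → w x i ≤ 1ℝ

maxOverInputs : ∀ {N} → (Input N → ℝ) → ℝ
maxOverInputs {zero}  g = g []
maxOverInputs {suc N} g =
  maxOverInputs (g ∘ (false ∷_)) ⊔ maxOverInputs (g ∘ (true ∷_))

objective : ∀ {N} → Weights N → ℝ
objective w = maxOverInputs λ x → ∑ (w x)

-- The optimal value is taken as the infimum over feasible families; classically
-- the feasible set is compact, so it is attained.  A relation, because the
-- Cauchy sequence representing a real is not unique.
record IsEC {N} (f : BoolFun N) (e : ℝ) : Set where
  field
    lowerBound : ∀ w → Feasible f w → e ≤ objective w
    approached : ∀ ε → 0ℝ < ε → ∃[ w ] (Feasible f w × objective w ≤ e + ε)

{-# OPTIONS --safe #-}
-- Take a code of length n whose distance 2D is linear in n, at distance at least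
-- 2D from the zero word, and such that every subcube through the zero word that
-- fixes at most D coordinates contains a codeword.  Then the zero word has no
-- small 0-certificate for the indicator g of the code.  Nevertheless weight 1/D
-- everywhere, raised to 1 at one coordinate where a non-codeword differs from the
-- only codeword within distance D (if any), separates it from all codewords, and
-- this has total weight n/D + 1 = O(1).  Let f be the OR of g over about n/43
-- disjoint blocks of n bits.  Certifying that all blocks are zero costs about D
-- per block, hence C(f) = Ω(n²).  Weights of total at most n are feasible:
-- 1 on the first block holding a codeword, or the weights above in every block if
-- there is none.  An input with exactly one codeword has n sensitive coordinates,
-- each of which must get weight 1, so EC(f) = n exactly.
--
-- The code is built greedily, one codeword per subcube.  The bits of a new word v
-- are chosen by conditional expectations so that ∑ 4^agreement(v, c) over the
-- words c already present stays below the value a single near word would force.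
module Submission where

import Algebra.Properties.CommutativeSemigroup as CommutativeSemigroupProperties
open import Data.Bool as Bool using (Bool; true; false; not; if_then_else_; _∨_)
import Data.Bool.Properties as Bool
open import Data.Fin using (Fin; zero; suc; _↑ˡ_)
open import Data.Integer as ℤ using ()
import Data.Integer.Properties as ℤ
open import Data.List as List using (List; []; _∷_; length; map)
import Data.List.Properties as List
open import Data.List.Extrema.Nat using (v≤min⁺; v≤max⁺)
import Data.List.Membership.DecPropositional as DecMembership
open import Data.List.Membership.Propositional using (find; lose) renaming (_∈_ to _∈ˡ_)
open import Data.List.Membership.Propositional.Properties
  using (∈-map⁺; ∈-++⁺ˡ; ∈-++⁺ʳ; ∈-cartesianProductWith⁺)
open import Data.List.Relation.Unary.All as All using (All; []; _∷_)
import Data.List.Relation.Unary.All.Properties as All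
open import Data.List.Relation.Unary.Any using (here; there; any?)
import Data.List.Relation.Unary.Any.Properties as Any
open import Data.Maybe using (just; nothing)
open import Data.Nat as ℕ using (ℕ; zero; suc; z≤n; s≤s)
import Data.Nat.DivMod as ℕ
import Data.Nat.Properties as ℕ
open import Data.Nat.Tactic.RingSolver using (solve-∀)
open import Data.Product using (∃-syntax; Σ-syntax; _×_; _,_; proj₁)
open import Data.Rational as ℚ using (ℚ; 0ℚ; 1ℚ; ½; fromℚᵘ; toℚᵘ)
import Data.Rational.Properties as ℚ
import Data.Rational.Solver as ℚ
open import Data.Rational.Unnormalised as ℚᵘ using (mkℚᵘ)
import Data.Rational.Unnormalised.Properties as ℚᵘ
open import Data.Sum using (_⊎_; inj₁; inj₂)
open import Data.Vec as Vec
  using (Vec; []; _∷_; _++_; replicate; lookup; zipWith; take; drop; updateAt; sum)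
import Data.Vec.Properties as Vec
open import Data.Vec.Relation.Unary.All using ([]; _∷_) renaming (All to Allⱽ)
import Data.Vec.Relation.Unary.All.Properties as Allⱽ
open import Function using (_∘_)
open import Relation.Binary.PropositionalEquality
  using (_≡_; _≢_; refl; sym; trans; cong; cong₂; subst; subst₂)
open import Relation.Nullary using (¬_; does; yes; no; contradiction)
open import Relation.Nullary.Decidable using (⌊_⌋; dec-true; dec-false)

open import Defs using
  (Input; BoolFun; Assignment; IsCertificate; _∈_; size; C; CAt; inputs; assignments)

module Combinatorics where

  open import Data.Nat using (_+_; _*_; _^_; _≤_; _<_)
  open ℕ.≤-Reasoning
  open CommutativeSemigroupProperties ℕ.+-commutativeSemigroup using ()
    renaming (interchange to +-interchange)
  open CommutativeSemigroupProperties ℕ.*-commutativeSemigroup using ()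
    renaming (interchange to *-interchange)

  -- Weighted Hamming distance and agreement.

  -- A Hamming distance with coordinate weights. With the entrywise product of two weight vectors as
  -- `w`, it is the discrete counterpart of `separation`; with all weights 1 it is the ordinary
  -- distance.
  sumDiff : ∀ {n} → Vec Bool n → Vec Bool n → Vec ℕ n → ℕ
  sumDiff []      []      []      = 0
  sumDiff (a ∷ x) (b ∷ y) (k ∷ w) = (if ⌊ a Bool.≟ b ⌋ then 0 else k) + sumDiff x y w

  sumDiff-sym : ∀ {n} (x y : Vec Bool n) w → sumDiff x y w ≡ sumDiff y x w
  sumDiff-sym [] [] [] = refl
  sumDiff-sym (false ∷ x) (false ∷ y) (k ∷ w) = sumDiff-sym x y w
  sumDiff-sym (false ∷ x) (true  ∷ y) (k ∷ w) = cong (k +_) (sumDiff-sym x y w)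
  sumDiff-sym (true  ∷ x) (false ∷ y) (k ∷ w) = cong (k +_) (sumDiff-sym x y w)
  sumDiff-sym (true  ∷ x) (true  ∷ y) (k ∷ w) = sumDiff-sym x y w

  hamming : ∀ {n} → Vec Bool n → Vec Bool n → ℕ
  hamming x y = sumDiff x y (replicate _ 1)

  hamming-triangle : ∀ {n} (x y z : Vec Bool n) → hamming x z ≤ hamming x y + hamming y z
  hamming-triangle [] [] [] = z≤n
  hamming-triangle (a ∷ x) (b ∷ y) (c ∷ z) = begin
    δ a c + hamming x z
      ≤⟨ ℕ.+-mono-≤ (δ-triangle a b c) (hamming-triangle x y z) ⟩
    (δ a b + δ b c) + (hamming x y + hamming y z)
      ≡⟨ +-interchange (δ a b) (δ b c) (hamming x y) (hamming y z) ⟩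
    (δ a b + hamming x y) + (δ b c + hamming y z) ∎
    where
    δ : Bool → Bool → ℕ
    δ a b = if ⌊ a Bool.≟ b ⌋ then 0 else 1
    δ-triangle : ∀ a b c → δ a c ≤ δ a b + δ b c
    δ-triangle false false c     = ℕ.≤-refl
    δ-triangle true  true  c     = ℕ.≤-refl
    δ-triangle false true  false = z≤n
    δ-triangle false true  true  = ℕ.≤-refl
    δ-triangle true  false false = ℕ.≤-refl
    δ-triangle true  false true  = z≤n

  match : Bool → Bool → ℕ
  match a b = if ⌊ a Bool.≟ b ⌋ then 1 else 0

  agreement : ∀ {n} → Vec Bool n → Vec Bool n → ℕ
  agreement []      []      = 0
  agreement (a ∷ x) (b ∷ y) = match a b + agreement x y

  agreement+hamming : ∀ {n} (x y : Vec Bool n) → agreement x y + hamming x y ≡ n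
  agreement+hamming [] [] = refl
  agreement+hamming (false ∷ x) (false ∷ y) = cong suc (agreement+hamming x y)
  agreement+hamming (false ∷ x) (true  ∷ y) = trans (ℕ.+-suc _ _) (cong suc (agreement+hamming x y))
  agreement+hamming (true  ∷ x) (false ∷ y) = trans (ℕ.+-suc _ _) (cong suc (agreement+hamming x y))
  agreement+hamming (true  ∷ x) (true  ∷ y) = cong suc (agreement+hamming x y)

  -- Exponential potential and conditional expectations.

  Centres : ℕ → Set
  Centres n = List (ℕ × Vec Bool n)

  potential : ∀ {n} → Centres n → Vec Bool n → ℕ
  potential []             v = 0
  potential ((w , c) ∷ cs) v = w * 4 ^ agreement v c + potential cs v

  mass : ∀ {n} → Centres n → ℕ
  mass []             = 0
  mass ((w , _) ∷ cs) = w + mass cs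

  -- The factor gained on the fixed bit moves into the weight, so a `potential` with known first bit
  -- is again a `potential`, on shorter words.
  fixBit : ∀ {n} → Bool → Centres (suc n) → Centres n
  fixBit b []                   = []
  fixBit b ((w , (a ∷ c)) ∷ cs) = (w * 4 ^ match b a , c) ∷ fixBit b cs

  potential-∷ : ∀ {n} b (cs : Centres (suc n)) v → potential cs (b ∷ v) ≡ potential (fixBit b cs) v
  potential-∷ b []                   v = refl
  potential-∷ b ((w , (a ∷ c)) ∷ cs) v = cong₂ _+_
    (trans (cong (w *_) (ℕ.^-distribˡ-+-* 4 (match b a) (agreement v c)))
      (sym (ℕ.*-assoc w (4 ^ match b a) (4 ^ agreement v c))))
    (potential-∷ b cs v)

  -- Each word agrees with exactly one of the two bits: its weight is multiplied by 4 for that bit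
  -- and by 1 for the other.
  mass-fixBit : ∀ {n} b (cs : Centres (suc n)) →
    mass (fixBit b cs) + mass (fixBit (not b) cs) ≡ 5 * mass cs
  mass-fixBit b []                   = refl
  mass-fixBit b ((w , (a ∷ c)) ∷ cs) = trans
    (+-interchange (w * 4 ^ match b a) (mass (fixBit b cs)) (w * 4 ^ match (not b) a) _)
    (trans (cong₂ _+_ (head b a) (mass-fixBit b cs)) (sym (ℕ.*-distribˡ-+ 5 w (mass cs))))
    where
    w4+w1 : ∀ w → w * 4 + w * 1 ≡ 5 * w
    w4+w1 = solve-∀
    w1+w4 : ∀ w → w * 1 + w * 4 ≡ 5 * w
    w1+w4 = solve-∀
    head : ∀ b a → w * 4 ^ match b a + w * 4 ^ match (not b) a ≡ 5 * w
    head false false = w4+w1 w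
    head false true  = w1+w4 w
    head true  false = w1+w4 w
    head true  true  = w4+w1 w

  -- The smaller of the two masses is at most their average, so a free bit can be chosen with growth
  -- factor 5/2 instead of 5.
  mass-halving : ∀ {n} (cs : Centres (suc n)) → ∃[ b ] 2 * mass (fixBit b cs) ≤ 5 * mass cs
  mass-halving cs = choose (ℕ.≤-total (mass (fixBit false cs)) (mass (fixBit true cs)))
    where
    half : ∀ b → mass (fixBit b cs) ≤ mass (fixBit (not b) cs) → 2 * mass (fixBit b cs) ≤ 5 * mass cs
    half b b≤ = begin
      mass (fixBit b cs) + (mass (fixBit b cs) + 0)     ≡⟨ cong (mass (fixBit b cs) +_) (ℕ.+-identityʳ _) ⟩
      mass (fixBit b cs) + mass (fixBit b cs)           ≤⟨ ℕ.+-monoʳ-≤ (mass (fixBit b cs)) b≤ ⟩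
      mass (fixBit b cs) + mass (fixBit (not b) cs)     ≡⟨ mass-fixBit b cs ⟩
      5 * mass cs                                       ∎
    choose : mass (fixBit false cs) ≤ mass (fixBit true cs)
           ⊎ mass (fixBit true cs) ≤ mass (fixBit false cs) →
      ∃[ b ] 2 * mass (fixBit b cs) ≤ 5 * mass cs
    choose (inj₁ f≤t) = false , half false f≤t
    choose (inj₂ t≤f) = true , half true t≤f

  ∈-just : ∀ {n} b {v : Input n} {A} → v ∈ A → b ∷ v ∈ just b ∷ A
  ∈-just b v∈A zero    = inj₁ refl
  ∈-just b v∈A (suc i) = v∈A i

  ∈-nothing : ∀ {n} b {v : Input n} {A} → v ∈ A → b ∷ v ∈ nothing ∷ A
  ∈-nothing b v∈A zero    = inj₂ refl
  ∈-nothing b v∈A (suc i) = v∈A i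

  -- Method of conditional expectations: on average over the subcube, the
  -- potential is at most 5ⁿ · mass / 2^(n − size A).
  low-potential : ∀ {n} (A : Assignment n) (cs : Centres n) →
    ∃[ v ] v ∈ A × 2 ^ n * potential cs v ≤ 2 ^ size A * (5 ^ n * mass cs)
  low-potential [] cs = [] , (λ ()) ,
    ℕ.≤-reflexive (cong (1 *_) (trans (potential-[] cs) (sym (ℕ.*-identityˡ (mass cs)))))
    where
    potential-[] : ∀ (cs : Centres 0) → potential cs [] ≡ mass cs
    potential-[] []              = refl
    potential-[] ((w , []) ∷ cs) = cong₂ _+_ (ℕ.*-identityʳ w) (potential-[] cs)
  low-potential {suc n} (just b ∷ A) cs with low-potential A (fixBit b cs)
  ... | v , v∈A , ih = b ∷ v , ∈-just b v∈A , (begin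
    2 * 2 ^ n * potential cs (b ∷ v)
      ≡⟨ cong (2 * 2 ^ n *_) (potential-∷ b cs v) ⟩
    2 * 2 ^ n * potential (fixBit b cs) v
      ≡⟨ ℕ.*-assoc 2 (2 ^ n) _ ⟩
    2 * (2 ^ n * potential (fixBit b cs) v)
      ≤⟨ ℕ.*-monoʳ-≤ 2 ih ⟩
    2 * (2 ^ size A * (5 ^ n * mass (fixBit b cs)))
      ≤⟨ ℕ.*-monoʳ-≤ 2 (ℕ.*-monoʳ-≤ (2 ^ size A) (ℕ.*-monoʳ-≤ (5 ^ n) mass-b)) ⟩
    2 * (2 ^ size A * (5 ^ n * (5 * mass cs)))
      ≡⟨ regroup (2 ^ size A) (5 ^ n) (mass cs) ⟩
    2 * 2 ^ size A * (5 * 5 ^ n * mass cs) ∎)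
    where
    -- A prescribed bit may be the worse one, so only the sum of both masses bounds it; `2 ^ size A`
    -- pays for the lost factor 2.
    mass-b : mass (fixBit b cs) ≤ 5 * mass cs
    mass-b = ℕ.≤-trans (ℕ.m≤m+n _ _) (ℕ.≤-reflexive (mass-fixBit b cs))
    regroup : ∀ s p m → 2 * (s * (p * (5 * m))) ≡ 2 * s * (5 * p * m)
    regroup = solve-∀
  low-potential {suc n} (nothing ∷ A) cs with mass-halving cs
  ... | b , half with low-potential A (fixBit b cs)
  ... | v , v∈A , ih = b ∷ v , ∈-nothing b v∈A , (begin
    2 * 2 ^ n * potential cs (b ∷ v)
      ≡⟨ cong (2 * 2 ^ n *_) (potential-∷ b cs v) ⟩
    2 * 2 ^ n * potential (fixBit b cs) v
      ≡⟨ ℕ.*-assoc 2 (2 ^ n) _ ⟩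
    2 * (2 ^ n * potential (fixBit b cs) v)
      ≤⟨ ℕ.*-monoʳ-≤ 2 ih ⟩
    2 * (2 ^ size A * (5 ^ n * mass (fixBit b cs)))
      ≡⟨ pull (2 ^ size A) (5 ^ n) (mass (fixBit b cs)) ⟩
    2 ^ size A * (5 ^ n * (2 * mass (fixBit b cs)))
      ≤⟨ ℕ.*-monoʳ-≤ (2 ^ size A) (ℕ.*-monoʳ-≤ (5 ^ n) half) ⟩
    2 ^ size A * (5 ^ n * (5 * mass cs))
      ≡⟨ regroup (2 ^ size A) (5 ^ n) (mass cs) ⟩
    2 ^ size A * (5 * 5 ^ n * mass cs) ∎)
    where
    pull : ∀ s p m → 2 * (s * (p * m)) ≡ s * (p * (2 * m))
    pull = solve-∀
    regroup : ∀ s p m → s * (p * (5 * m)) ≡ s * (5 * p * m)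
    regroup = solve-∀

  -- A word of a subcube far from all given words.

  Far : ∀ {n} → ℕ → Vec Bool n → Vec Bool n → Set
  Far d x y = d ≤ hamming x y

  unitWeights : ∀ {n} → List (Vec Bool n) → Centres n
  unitWeights = map (1 ,_)

  mass-unitWeights : ∀ {n} (cs : List (Vec Bool n)) → mass (unitWeights cs) ≡ length cs
  mass-unitWeights []       = refl
  mass-unitWeights (c ∷ cs) = cong suc (mass-unitWeights cs)

  4^agreement≤potential : ∀ {n} (v : Vec Bool n) {c cs} → c ∈ˡ cs →
    4 ^ agreement v c ≤ potential (unitWeights cs) v
  4^agreement≤potential v {c} (here refl) =
    ℕ.≤-trans (ℕ.≤-reflexive (sym (ℕ.*-identityˡ (4 ^ agreement v c)))) (ℕ.m≤m+n _ _)
  4^agreement≤potential v {cs = c′ ∷ _} (there c∈cs) =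
    ℕ.≤-trans (4^agreement≤potential v c∈cs) (ℕ.m≤n+m _ (1 * 4 ^ agreement v c′))

  -- The condition under which the averaging bound of low-potential leaves no room
  -- for a centre at distance less than d from the chosen word.
  Sparse : (n k d : ℕ) → Set
  Sparse n k d = 2 ^ k * 4 ^ d * 4 ^ k * (5 ^ n * 5 ^ n) ≤ 2 ^ n * 4 ^ n * 4 ^ n

  -- A centre at distance below `d` would contribute, by itself, more than the whole potential that
  -- `low-potential` allows. The bound on `length cs` has the shape of the count in
  -- `subcubes-length`, since one word is chosen per subcube.
  ∃-far : ∀ {n k d} → Sparse n k d → (A : Assignment n) → size A ≤ k →
    (cs : List (Vec Bool n)) → length cs * 4 ^ n ≤ 5 ^ n * 4 ^ k →
    ∃[ v ] v ∈ A × All (Far d v) cs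
  ∃-far {n} {k} {d} sparse A ∣A∣≤k cs few with low-potential A (unitWeights cs)
  ... | v , v∈A , low = v , v∈A , All.tabulate λ {c} c∈cs → far c c∈cs
    where
    far : ∀ c → c ∈ˡ cs → Far d v c
    far c c∈cs with d ℕ.≤? hamming v c
    ... | yes d≤ = d≤
    ... | no  d≰ = contradiction too-large (ℕ.<⇒≱ (ℕ.m<m*n P 4 {{P-nz}} (s≤s (s≤s z≤n))))
      where
      P : ℕ
      P = 2 ^ n * 4 ^ n * 4 ^ n
      P-nz : ℕ.NonZero P
      P-nz = ℕ.m*n≢0 (2 ^ n * 4 ^ n) (4 ^ n)
        {{ℕ.m*n≢0 (2 ^ n) (4 ^ n) {{ℕ.m^n≢0 2 n}} {{ℕ.m^n≢0 4 n}}}} {{ℕ.m^n≢0 4 n}}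
      a : ℕ
      a = agreement v c
      -- The strict inequality `hamming v c < d` gives the extra 1, that is, the factor 4 that makes
      -- `P * 4 ≤ P` absurd.
      1+n≤a+d : suc n ≤ a + d
      1+n≤a+d = begin-strict
        n                   ≡⟨ agreement+hamming v c ⟨
        a + hamming v c     <⟨ ℕ.+-monoʳ-< a (ℕ.≰⇒> d≰) ⟩
        a + d               ∎
      e₁ : ∀ s p → s * p * p * 4 ≡ s * p * (4 * p)
      e₁ = solve-∀
      e₂ : ∀ s p q r → s * p * (q * r) ≡ s * q * (p * r)
      e₂ = solve-∀
      e₃ : ∀ s f m p r → s * (f * m) * (p * r) ≡ s * r * f * (m * p)
      e₃ = solve-∀
      e₄ : ∀ s r f q → s * r * f * (f * q) ≡ s * r * q * (f * f)
      e₄ = solve-∀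
      too-large : P * 4 ≤ P
      too-large = begin
        2 ^ n * 4 ^ n * 4 ^ n * 4               ≡⟨ e₁ (2 ^ n) (4 ^ n) ⟩
        2 ^ n * 4 ^ n * 4 ^ suc n               ≤⟨ ℕ.*-monoʳ-≤ (2 ^ n * 4 ^ n) (ℕ.^-monoʳ-≤ 4 1+n≤a+d) ⟩
        2 ^ n * 4 ^ n * 4 ^ (a + d)             ≡⟨ cong (2 ^ n * 4 ^ n *_) (ℕ.^-distribˡ-+-* 4 a d) ⟩
        2 ^ n * 4 ^ n * (4 ^ a * 4 ^ d)         ≡⟨ e₂ (2 ^ n) (4 ^ n) (4 ^ a) (4 ^ d) ⟩
        2 ^ n * 4 ^ a * (4 ^ n * 4 ^ d)         ≤⟨ ℕ.*-monoˡ-≤ (4 ^ n * 4 ^ d) (ℕ.≤-trans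
                                                    (ℕ.*-monoʳ-≤ (2 ^ n) (4^agreement≤potential v c∈cs)) low) ⟩
        2 ^ size A * (5 ^ n * mass (unitWeights cs)) * (4 ^ n * 4 ^ d)
          ≤⟨ ℕ.*-monoˡ-≤ (4 ^ n * 4 ^ d) (ℕ.*-mono-≤ (ℕ.^-monoʳ-≤ 2 ∣A∣≤k)
               (ℕ.≤-reflexive (cong (5 ^ n *_) (mass-unitWeights cs)))) ⟩
        2 ^ k * (5 ^ n * length cs) * (4 ^ n * 4 ^ d)
          ≡⟨ e₃ (2 ^ k) (5 ^ n) (length cs) (4 ^ n) (4 ^ d) ⟩
        2 ^ k * 4 ^ d * 5 ^ n * (length cs * 4 ^ n)
          ≤⟨ ℕ.*-monoʳ-≤ (2 ^ k * 4 ^ d * 5 ^ n) few ⟩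
        2 ^ k * 4 ^ d * 5 ^ n * (5 ^ n * 4 ^ k)
          ≡⟨ e₄ (2 ^ k) (4 ^ d) (5 ^ n) (4 ^ k) ⟩
        2 ^ k * 4 ^ d * 4 ^ k * (5 ^ n * 5 ^ n) ≤⟨ sparse ⟩
        P                                       ∎

  -- Subcubes through the zero word.

  zeros : ∀ n → Vec Bool n
  zeros n = replicate n false

  -- A subcube containing the zero word can fix bits to `false` only, so no `just true` occurs.
  subcubes : ∀ n → ℕ → List (Assignment n)
  subcubes zero    k       = [] ∷ []
  subcubes (suc n) zero    = map (nothing ∷_) (subcubes n zero)
  subcubes (suc n) (suc k) =
    map (just false ∷_) (subcubes n k) List.++ map (nothing ∷_) (subcubes n (suc k))

  subcubes-size : ∀ n k → All (λ A → size A ≤ k) (subcubes n k)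
  subcubes-size zero    k       = z≤n ∷ []
  subcubes-size (suc n) zero    = All.map⁺ (subcubes-size n zero)
  subcubes-size (suc n) (suc k) = All.++⁺
    (All.map⁺ (All.map s≤s (subcubes-size n k))) (All.map⁺ (subcubes-size n (suc k)))

  subcubes-complete : ∀ {n} k (A : Assignment n) → zeros n ∈ A → size A ≤ k → A ∈ˡ subcubes n k
  subcubes-complete k [] 0∈A ∣A∣≤k = here refl
  subcubes-complete zero (nothing ∷ A) 0∈A ∣A∣≤k =
    ∈-map⁺ (nothing ∷_) (subcubes-complete zero A (0∈A ∘ suc) ∣A∣≤k)
  subcubes-complete {suc n} (suc k) (nothing ∷ A) 0∈A ∣A∣≤k =
    ∈-++⁺ʳ (map (just false ∷_) (subcubes n k))
      (∈-map⁺ (nothing ∷_) (subcubes-complete (suc k) A (0∈A ∘ suc) ∣A∣≤k))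
  subcubes-complete (suc k) (just b ∷ A) 0∈A (s≤s ∣A∣≤k) with 0∈A zero
  ... | inj₁ refl = ∈-++⁺ˡ (∈-map⁺ (just false ∷_) (subcubes-complete k A (0∈A ∘ suc) ∣A∣≤k))

  -- The count is the sum of the binomials (n choose j) over j ≤ k. Weighting each term by 4^(k-j) ≥
  -- 1 bounds it by 4^k (1 + 1/4)^n; the induction follows Pascal's rule.
  subcubes-length : ∀ n k → length (subcubes n k) * 4 ^ n ≤ 5 ^ n * 4 ^ k
  subcubes-length zero    k    = ℕ.*-monoʳ-≤ 1 (ℕ.m^n>0 4 k)
  subcubes-length (suc n) zero = begin
    length (map (nothing ∷_) (subcubes n 0)) * (4 * 4 ^ n)
      ≡⟨ cong (_* (4 * 4 ^ n)) (List.length-map (nothing ∷_) (subcubes n 0)) ⟩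
    length (subcubes n 0) * (4 * 4 ^ n)     ≡⟨ pull (length (subcubes n 0)) (4 ^ n) ⟩
    4 * (length (subcubes n 0) * 4 ^ n)     ≤⟨ ℕ.*-mono-≤ (ℕ.n≤1+n 4) (subcubes-length n 0) ⟩
    5 * (5 ^ n * 1)                         ≡⟨ ℕ.*-assoc 5 (5 ^ n) 1 ⟨
    5 * 5 ^ n * 1                           ∎
    where
    pull : ∀ l p → l * (4 * p) ≡ 4 * (l * p)
    pull = solve-∀
  subcubes-length (suc n) (suc k) = begin
    length (map (just false ∷_) (subcubes n k) List.++ map (nothing ∷_) (subcubes n (suc k))) * (4 * 4 ^ n)
      ≡⟨ cong (_* (4 * 4 ^ n)) (trans (List.length-++ (map (just false ∷_) (subcubes n k)))
           (cong₂ _+_ (List.length-map (just false ∷_) (subcubes n k))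
             (List.length-map (nothing ∷_) (subcubes n (suc k))))) ⟩
    (l + m) * (4 * 4 ^ n)                       ≡⟨ pull l m (4 ^ n) ⟩
    4 * (l * 4 ^ n + m * 4 ^ n)                 ≤⟨ ℕ.*-monoʳ-≤ 4 (ℕ.+-mono-≤ (subcubes-length n k)
                                                                             (subcubes-length n (suc k))) ⟩
    4 * (5 ^ n * 4 ^ k + 5 ^ n * (4 * 4 ^ k))   ≡⟨ regroup (5 ^ n) (4 ^ k) ⟩
    5 * 5 ^ n * (4 * 4 ^ k)                     ∎
    where
    l m : ℕ
    l = length (subcubes n k)
    m = length (subcubes n (suc k))
    pull : ∀ l m p → (l + m) * (4 * p) ≡ 4 * (l * p + m * p)
    pull = solve-∀
    regroup : ∀ p q → 4 * (p * q + p * (4 * q)) ≡ 5 * p * (4 * q)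
    regroup = solve-∀

  -- Greedy construction of the code.

  record Code (n k d : ℕ) : Set where
    field
      words    : List (Vec Bool n)
      nonzero  : All (Far d (zeros n)) words
      distance : ∀ {y z} → y ∈ˡ words → z ∈ˡ words → y ≡ z ⊎ Far d y z
      hits     : ∀ A → zeros n ∈ A → size A ≤ k → ∃[ y ] y ∈ A × y ∈ˡ words

  module _ {n k d : ℕ} (sparse : Sparse n k d) where

    -- The list `cs` holds the words to be avoided, `ws` only the new ones. Each round moves one
    -- unit from `As` to `cs`, so the budget on their joint length is invariant; cancelling the
    -- `4 ^ n` of the current subcube leaves the bound that `∃-far` asks for.
    greedy : (As : List (Assignment n)) → All (λ A → size A ≤ k) As →
      (cs : List (Vec Bool n)) → (length As + length cs) * 4 ^ n ≤ 5 ^ n * 4 ^ k + 4 ^ n →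
      ∃[ ws ] All (λ w → All (Far d w) cs) ws
        × (∀ {y z} → y ∈ˡ ws → z ∈ˡ ws → y ≡ z ⊎ Far d y z)
        × (∀ {A} → A ∈ˡ As → ∃[ y ] y ∈ A × y ∈ˡ ws)
    greedy [] [] cs few = [] , [] , (λ ()) , (λ ())
    greedy (A ∷ As) (∣A∣≤k ∷ sizes) cs few
      with ∃-far sparse A ∣A∣≤k cs (ℕ.+-cancelˡ-≤ (4 ^ n) _ _ (begin
        4 ^ n + length cs * 4 ^ n             ≤⟨ ℕ.*-monoˡ-≤ (4 ^ n) (s≤s (ℕ.m≤n+m (length cs) (length As))) ⟩
        (length (A ∷ As) + length cs) * 4 ^ n ≤⟨ few ⟩
        5 ^ n * 4 ^ k + 4 ^ n                 ≡⟨ ℕ.+-comm _ (4 ^ n) ⟩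
        4 ^ n + 5 ^ n * 4 ^ k                 ∎))
    ... | v , v∈A , v-far with greedy As sizes (v ∷ cs)
      (subst (λ m → m * 4 ^ n ≤ 5 ^ n * 4 ^ k + 4 ^ n) (sym (ℕ.+-suc (length As) (length cs))) few)
    ... | ws , ws-far , ws-dist , ws-hits =
      v ∷ ws , v-far ∷ All.map All.tail ws-far , dist , hit
      where
      dist : ∀ {y z} → y ∈ˡ v ∷ ws → z ∈ˡ v ∷ ws → y ≡ z ⊎ Far d y z
      dist (here refl) (here refl) = inj₁ refl
      dist {y} {z} (here refl) (there z∈) =
        inj₂ (subst (d ≤_) (sumDiff-sym z y (replicate n 1)) (All.head (All.lookup ws-far z∈)))
      dist (there y∈) (here refl) = inj₂ (All.head (All.lookup ws-far y∈))
      dist (there y∈) (there z∈) = ws-dist y∈ z∈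
      hit : ∀ {B} → B ∈ˡ A ∷ As → ∃[ y ] y ∈ B × y ∈ˡ v ∷ ws
      hit (here refl) = v , v∈A , here refl
      hit (there B∈) with ws-hits B∈
      ... | y , y∈B , y∈ws = y , y∈B , there y∈ws

    code : Code n k d
    -- Starting from the zero word as a word to be avoided yields `nonzero`; the extra `4 ^ n` in
    -- the budget pays for it.
    code with greedy (subcubes n k) (subcubes-size n k) (zeros n ∷ []) few
      where
      few : (length (subcubes n k) + 1) * 4 ^ n ≤ 5 ^ n * 4 ^ k + 4 ^ n
      few = begin
        (length (subcubes n k) + 1) * 4 ^ n
          ≡⟨ ℕ.*-distribʳ-+ (4 ^ n) (length (subcubes n k)) 1 ⟩
        length (subcubes n k) * 4 ^ n + 1 * 4 ^ n
          ≤⟨ ℕ.+-mono-≤ (subcubes-length n k) (ℕ.≤-reflexive (ℕ.*-identityˡ (4 ^ n))) ⟩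
        5 ^ n * 4 ^ k + 4 ^ n ∎
    ... | ws , far , dist , hit = record
      { words    = ws
      ; nonzero  = All.map (λ {w} w-far →
          subst (d ≤_) (sumDiff-sym w (zeros n) (replicate n 1)) (All.head w-far)) far
      ; distance = dist
      ; hits     = λ A 0∈A ∣A∣≤k → hit (subcubes-complete k A 0∈A ∣A∣≤k)
      }

  -- With `k = D` and `d = 2 * D` the two sides become 128^D 25^n and 32^n. Spending 21 coordinates
  -- per unit of `D` is enough because 128 · 25^21 ≤ 32^21, which is checked by evaluation.
  sparse-21 : ∀ D r → Sparse (D * 21 + r) D (2 * D)
  sparse-21 D r = begin
    2 ^ D * 4 ^ (2 * D) * 4 ^ D * (5 ^ n * 5 ^ n)
      ≡⟨ cong (λ t → 2 ^ D * t * 4 ^ D * (5 ^ n * 5 ^ n)) (sym (ℕ.^-*-assoc 4 2 D)) ⟩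
    2 ^ D * 16 ^ D * 4 ^ D * (5 ^ n * 5 ^ n)
      ≡⟨ cong₂ _*_ (trans (cong (_* 4 ^ D) (*-^ 2 16 D)) (*-^ 32 4 D)) (*-^ 5 5 n) ⟩
    128 ^ D * 25 ^ n
      ≡⟨ cong (128 ^ D *_) (^-split 25) ⟩
    128 ^ D * ((25 ^ 21) ^ D * 25 ^ r)
      ≡⟨ ℕ.*-assoc (128 ^ D) _ (25 ^ r) ⟨
    128 ^ D * (25 ^ 21) ^ D * 25 ^ r
      ≡⟨ cong (_* 25 ^ r) (*-^ 128 (25 ^ 21) D) ⟩
    (128 * 25 ^ 21) ^ D * 25 ^ r
      ≤⟨ ℕ.*-mono-≤ (ℕ.^-monoˡ-≤ D (ℕ.≤ᵇ⇒≤ (128 * 25 ^ 21) (32 ^ 21) _))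
                    (ℕ.^-monoˡ-≤ r (ℕ.≤ᵇ⇒≤ 25 32 _)) ⟩
    (32 ^ 21) ^ D * 32 ^ r
      ≡⟨ ^-split 32 ⟨
    32 ^ n
      ≡⟨ trans (cong (_* 4 ^ n) (*-^ 2 4 n)) (*-^ 8 4 n) ⟨
    2 ^ n * 4 ^ n * 4 ^ n ∎
    where
    n : ℕ
    n = D * 21 + r
    *-^ : ∀ a b m → a ^ m * b ^ m ≡ (a * b) ^ m
    *-^ a b zero    = refl
    *-^ a b (suc m) = trans (*-interchange a (a ^ m) b (b ^ m)) (cong (a * b *_) (*-^ a b m))
    ^-split : ∀ b → b ^ n ≡ (b ^ 21) ^ D * b ^ r
    ^-split b = trans (ℕ.^-distribˡ-+-* b (D * 21) r)
      (cong (_* b ^ r) (trans (cong (b ^_) (ℕ.*-comm D 21)) (sym (ℕ.^-*-assoc b 21 D))))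

  -- Arithmetic of weight vectors.

  sumDiff-++ : ∀ {m n} (x y : Vec Bool m) (x′ y′ : Vec Bool n) w w′ →
    sumDiff (x ++ x′) (y ++ y′) (w ++ w′) ≡ sumDiff x y w + sumDiff x′ y′ w′
  sumDiff-++ [] [] x′ y′ [] w′ = refl
  sumDiff-++ (a ∷ x) (b ∷ y) x′ y′ (k ∷ w) w′ = trans
    (cong ((if ⌊ a Bool.≟ b ⌋ then 0 else k) +_) (sumDiff-++ x y x′ y′ w w′))
    (sym (ℕ.+-assoc (if ⌊ a Bool.≟ b ⌋ then 0 else k) (sumDiff x y w) _))

  sumDiff-scale : ∀ {n} k (x y : Vec Bool n) w →
    sumDiff x y (Vec.map (k *_) w) ≡ k * sumDiff x y w
  sumDiff-scale k [] [] [] = sym (ℕ.*-zeroʳ k)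
  sumDiff-scale k (a ∷ x) (b ∷ y) (c ∷ w) with ⌊ a Bool.≟ b ⌋
  ... | true  = sumDiff-scale k x y w
  ... | false = trans (cong (k * c +_) (sumDiff-scale k x y w)) (sym (ℕ.*-distribˡ-+ k c _))

  hamming≤sumDiff : ∀ {n} (x y : Vec Bool n) {w} → Allⱽ (1 ≤_) w → hamming x y ≤ sumDiff x y w
  hamming≤sumDiff [] [] [] = z≤n
  hamming≤sumDiff (a ∷ x) (b ∷ y) (1≤k ∷ 1≤w) with ⌊ a Bool.≟ b ⌋
  ... | true  = hamming≤sumDiff x y 1≤w
  ... | false = ℕ.+-mono-≤ 1≤k (hamming≤sumDiff x y 1≤w)

  replicate-All : ∀ {P : ℕ → Set} {k} → P k → ∀ m → Allⱽ P (replicate m k)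
  replicate-All p zero    = []
  replicate-All p (suc m) = p ∷ replicate-All p m

  sum-replicate : ∀ m k → sum (replicate m k) ≡ m * k
  sum-replicate zero    k = refl
  sum-replicate (suc m) k = cong (k +_) (sum-replicate m k)

  sum-zeros : ∀ m → sum (replicate m 0) ≡ 0
  sum-zeros m = trans (sum-replicate m 0) (ℕ.*-zeroʳ m)

  sum-ones : ∀ m → sum (replicate m 1) ≡ m
  sum-ones m = trans (sum-replicate m 1) (ℕ.*-identityʳ m)

  -- Discrete weightings and hard zeros.

  -- Natural weights, in units of 1/D.
  record Weighting (D : ℕ) {N} (f : BoolFun N) (total₀ total₁ : ℕ) : Set where
    field
      weight    : Input N → Vec ℕ N
      bounded   : ∀ x → Allⱽ (_≤ D) (weight x)
      separated : ∀ x y → f x ≡ true → f y ≡ false →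
                  D * D ≤ sumDiff x y (zipWith _*_ (weight x) (weight y))
      sum₀      : ∀ x → f x ≡ false → sum (weight x) ≤ total₀
      sum₁      : ∀ x → f x ≡ true → sum (weight x) ≤ total₁

  -- A certificate lower bound at a named 0-input, in a form that adds up under OR on disjoint
  -- blocks.
  record HardZero {N} (f : BoolFun N) (s : ℕ) : Set where
    field
      input : Input N
      zero₀ : f input ≡ false
      hard  : ∀ A → input ∈ A → IsCertificate f false A → s ≤ size A

  ∈-inputs : ∀ {N} (x : Input N) → x ∈ˡ inputs N
  ∈-inputs [] = here refl
  ∈-inputs (b ∷ x) = ∈-cartesianProductWith⁺ _∷_ (∈-bits b) (∈-inputs x)
    where
    ∈-bits : ∀ b → b ∈ˡ false ∷ true ∷ []
    ∈-bits false = here refl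
    ∈-bits true  = there (here refl)

  hard⇒≤C : ∀ {N} {f : BoolFun N} {s} → HardZero f s → s ≤ C f
  hard⇒≤C {N} {f} {s} h = v≤max⁺ 0 _ (inj₂ (Any.map⁺ (lose (∈-inputs input) s≤CAt)))
    where
    open HardZero h
    hard′ : ∀ A → input ∈ A → IsCertificate f (f input) A → s ≤ size A
    hard′ A x∈A cert = hard A x∈A (subst (λ b → IsCertificate f b A) zero₀ cert)
    size-total : ∀ {n} (x : Input n) → size (Vec.map just x) ≡ n
    size-total []      = refl
    size-total (b ∷ x) = cong suc (size-total x)
    total-unique : ∀ {n} (x y : Input n) → y ∈ Vec.map just x → y ≡ x
    total-unique [] [] _ = refl
    total-unique (a ∷ x) (b ∷ y) y∈ with y∈ zero
    ... | inj₁ refl = cong (a ∷_) (total-unique x y (y∈ ∘ suc))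
    -- `CAt` takes the minimum with default value `N`, so `s` must be compared with `N` too; the
    -- total assignment of `input` is a certificate of that size.
    s≤N : s ≤ N
    s≤N = subst (s ≤_) (size-total input) (hard′ (Vec.map just input)
      (λ i → inj₁ (sym (Vec.lookup-map i just input)))
      (λ y y∈ → cong f (total-unique input y y∈)))
    s≤CAt : s ≤ CAt f input
    s≤CAt = v≤min⁺ s≤N (All.map⁺ (All.map (λ {A} (x∈A , cert) → hard′ A x∈A cert)
      (All.all-filter _ (assignments N))))

  -- OR on disjoint blocks.

  infixr 5 _∨ᶠ_

  _∨ᶠ_ : ∀ {m n} → BoolFun m → BoolFun n → BoolFun (m + n)
  _∨ᶠ_ {m} f g x = f (take m x) ∨ g (drop m x)

  take-++ : ∀ {m n} (x : Input m) (y : Input n) → take m (x ++ y) ≡ x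
  take-++ []      y = refl
  take-++ (a ∷ x) y = cong (a ∷_) (take-++ x y)

  drop-++ : ∀ {m n} (x : Input m) (y : Input n) → drop m (x ++ y) ≡ y
  drop-++ []      y = refl
  drop-++ (a ∷ x) y = drop-++ x y

  ∨ᶠ-++ : ∀ {m n} (f : BoolFun m) (g : BoolFun n) x y → (f ∨ᶠ g) (x ++ y) ≡ f x ∨ g y
  ∨ᶠ-++ f g x y = cong₂ _∨_ (cong f (take-++ x y)) (cong g (drop-++ x y))

  module _ {m n} {f : BoolFun m} {g : BoolFun n} where

    -- A 0-certificate of the OR restricts to a 0-certificate on each block: any input of one block
    -- is completed by the hard zero of the other. The sizes of the two restrictions add.
    ∨-hard : ∀ {s t} → HardZero f s → HardZero g t → HardZero (f ∨ᶠ g) (s + t)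
    ∨-hard {s} {t} hf hg = record
      { input = F.input ++ G.input
      ; zero₀ = trans (∨ᶠ-++ f g F.input G.input) (cong₂ _∨_ F.zero₀ G.zero₀)
      ; hard  = λ A x∈A cert → subst
          (λ A → F.input ++ G.input ∈ A → IsCertificate (f ∨ᶠ g) false A → s + t ≤ size A)
          (Vec.take++drop≡id m A) (split-hard (take m A) (drop m A)) x∈A cert
      }
      where
      module F = HardZero hf
      module G = HardZero hg
      size-++ : ∀ {m n} (A : Assignment m) (B : Assignment n) → size (A ++ B) ≡ size A + size B
      size-++ []            B = refl
      size-++ (nothing ∷ A) B = size-++ A B
      size-++ (just _ ∷ A)  B = cong suc (size-++ A B)
      ∈-++ : ∀ {m n} (x : Input m) {y : Input n} A {B} → x ∈ A → y ∈ B → x ++ y ∈ A ++ B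
      ∈-++ []      []      x∈A y∈B i       = y∈B i
      ∈-++ (_ ∷ x) (_ ∷ A) x∈A y∈B zero    = x∈A zero
      ∈-++ (_ ∷ x) (_ ∷ A) x∈A y∈B (suc i) = ∈-++ x A (x∈A ∘ suc) y∈B i
      ++-∈ˡ : ∀ {m n} (x : Input m) {y : Input n} A {B} → x ++ y ∈ A ++ B → x ∈ A
      ++-∈ˡ (_ ∷ x) (_ ∷ A) xy∈ zero    = xy∈ zero
      ++-∈ˡ (_ ∷ x) (_ ∷ A) xy∈ (suc i) = ++-∈ˡ x A (xy∈ ∘ suc) i
      ++-∈ʳ : ∀ {m n} (x : Input m) {y : Input n} (A : Assignment m) {B} → x ++ y ∈ A ++ B → y ∈ B
      ++-∈ʳ []      []      xy∈ = xy∈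
      ++-∈ʳ (_ ∷ x) (_ ∷ A) xy∈ = ++-∈ʳ x A (xy∈ ∘ suc)
      split-hard : ∀ A B → F.input ++ G.input ∈ A ++ B →
        IsCertificate (f ∨ᶠ g) false (A ++ B) → s + t ≤ size (A ++ B)
      split-hard A B xy∈ cert = subst (s + t ≤_) (sym (size-++ A B)) (ℕ.+-mono-≤
        (F.hard A x∈A λ x′ x′∈A →
          Bool.∨-conicalˡ _ _ (trans (sym (∨ᶠ-++ f g x′ G.input)) (cert _ (∈-++ x′ A x′∈A y∈B))))
        (G.hard B y∈B λ y′ y′∈B →
          Bool.∨-conicalʳ (f F.input) _
            (trans (sym (∨ᶠ-++ f g F.input y′)) (cert _ (∈-++ F.input A x∈A y′∈B)))))
        where
        x∈A : F.input ∈ A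
        x∈A = ++-∈ˡ F.input A xy∈
        y∈B : G.input ∈ B
        y∈B = ++-∈ʳ F.input A xy∈

    -- A 1-input puts weight only on one block of value `true`, so the total for 1-inputs does not
    -- grow, whereas a 0-input uses both blocks and its totals add. On the chosen block the 0-input
    -- has value `false` and keeps its own weights, so the separation there already suffices.
    ∨-weighting : ∀ {D a b t} → Weighting D f a t → Weighting D g b t →
      Weighting D (f ∨ᶠ g) (a + b) t
    ∨-weighting {D} {a} {b} {t} wf wg = record
      { weight    = λ x → w (take m x) (drop m x)
      ; bounded   = λ x → w-bounded (take m x) (drop m x)
      ; separated = λ x y fx fy → subst₂
          (λ x′ y′ → D * D ≤ sumDiff x′ y′
            (zipWith _*_ (w (take m x) (drop m x)) (w (take m y) (drop m y))))
          (Vec.take++drop≡id m x) (Vec.take++drop≡id m y)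
          (w-separated (take m x) (take m y) (drop m x) (drop m y) fx fy)
      ; sum₀      = λ x → w-sum₀ (take m x) (drop m x)
      ; sum₁      = λ x → w-sum₁ (take m x) (drop m x)
      }
      where
      module F = Weighting wf
      module G = Weighting wg
      w : Input m → Input n → Vec ℕ (m + n)
      w x y = if f x then F.weight x ++ replicate n 0 else
              if g y then replicate m 0 ++ G.weight y else F.weight x ++ G.weight y

      w-bounded : ∀ x y → Allⱽ (_≤ D) (w x y)
      w-bounded x y with f x | g y
      ... | true  | _     = Allⱽ.++⁺ (F.bounded x) (replicate-All z≤n n)
      ... | false | true  = Allⱽ.++⁺ (replicate-All z≤n m) (G.bounded y)
      ... | false | false = Allⱽ.++⁺ (F.bounded x) (G.bounded y)

      w-sum₀ : ∀ x y → f x ∨ g y ≡ false → sum (w x y) ≤ a + b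
      w-sum₀ x y fg with f x in fx | g y in gy
      ... | false | false = ℕ.≤-trans (ℕ.≤-reflexive (Vec.sum-++ (F.weight x)))
        (ℕ.+-mono-≤ (F.sum₀ x fx) (G.sum₀ y gy))
      w-sum₁ : ∀ x y → f x ∨ g y ≡ true → sum (w x y) ≤ t
      w-sum₁ x y fg with f x in fx | g y in gy
      ... | true  | _    = ℕ.≤-trans (ℕ.≤-reflexive (trans (Vec.sum-++ (F.weight x))
        (trans (cong (sum (F.weight x) +_) (sum-zeros n)) (ℕ.+-identityʳ _)))) (F.sum₁ x fx)
      ... | false | true = ℕ.≤-trans (ℕ.≤-reflexive (trans (Vec.sum-++ (replicate m 0))
        (cong (_+ sum (G.weight y)) (sum-zeros m)))) (G.sum₁ y gy)

      split : ∀ x x′ y y′ (u u′ : Vec ℕ m) (v v′ : Vec ℕ n) →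
        sumDiff (x ++ y) (x′ ++ y′) (zipWith _*_ (u ++ v) (u′ ++ v′))
          ≡ sumDiff x x′ (zipWith _*_ u u′) + sumDiff y y′ (zipWith _*_ v v′)
      split x x′ y y′ u u′ v v′ = trans
        (cong (sumDiff (x ++ y) (x′ ++ y′)) (Vec.zipWith-++ _*_ u v u′ v′))
        (sumDiff-++ x x′ y y′ _ _)
      w-separated : ∀ x x′ y y′ → f x ∨ g y ≡ true → f x′ ∨ g y′ ≡ false →
        D * D ≤ sumDiff (x ++ y) (x′ ++ y′) (zipWith _*_ (w x y) (w x′ y′))
      w-separated x x′ y y′ t₁ t₂ with f x in fx | g y in gy | f x′ in fx′ | g y′ in gy′
      ... | true  | _    | false | false =
        subst (D * D ≤_) (sym (split x x′ y y′ (F.weight x) (F.weight x′) _ _))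
        (ℕ.≤-trans (F.separated x x′ fx fx′) (ℕ.m≤m+n _ _))
      ... | false | true | false | false =
        subst (D * D ≤_) (sym (split x x′ y y′ _ (F.weight x′) (G.weight y) _))
        (ℕ.≤-trans (G.separated y y′ gy gy′) (ℕ.m≤n+m _ _))

  -- One block: weights and certificates for the indicator of the code.

  hamming-refl : ∀ {m} (x : Vec Bool m) → hamming x x ≡ 0
  hamming-refl []          = refl
  hamming-refl (false ∷ x) = hamming-refl x
  hamming-refl (true ∷ x)  = hamming-refl x

  flipBit : ∀ {m} → Input m → Fin m → Input m
  flipBit x i = updateAt x i not

  hamming-flip : ∀ {m} (x : Input m) i → hamming x (flipBit x i) ≡ 1
  hamming-flip (false ∷ x) zero = cong suc (hamming-refl x)
  hamming-flip (true  ∷ x) zero = cong suc (hamming-refl x)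
  hamming-flip (false ∷ x) (suc i) = hamming-flip x i
  hamming-flip (true  ∷ x) (suc i) = hamming-flip x i

  -- In units of 1/`D`: full weight at the first difference, so that this coordinate alone
  -- separates, and 1/`D` elsewhere.
  spike : ∀ {m} → ℕ → Vec Bool m → Vec Bool m → Vec ℕ m
  spike D [] [] = []
  spike D (a ∷ x) (b ∷ y) = if ⌊ a Bool.≟ b ⌋ then 1 ∷ spike D x y else D ∷ replicate _ 1

  spike-All : ∀ {P : ℕ → Set} → P 1 → ∀ {D} → P D → ∀ {m} (x y : Vec Bool m) → Allⱽ P (spike D x y)
  spike-All p q [] [] = []
  spike-All p q (a ∷ x) (b ∷ y) with ⌊ a Bool.≟ b ⌋
  ... | true  = p ∷ spike-All p q x y
  ... | false = q ∷ replicate-All p _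

  spike-sum : ∀ {m} D (x y : Vec Bool m) → sum (spike D x y) ≤ m + D
  spike-sum D [] [] = z≤n
  spike-sum {suc m} D (a ∷ x) (b ∷ y) with ⌊ a Bool.≟ b ⌋
  ... | true  = s≤s (spike-sum D x y)
  ... | false = begin
    D + sum (replicate m 1) ≡⟨ cong (D +_) (sum-ones m) ⟩
    D + m                   ≡⟨ ℕ.+-comm D m ⟩
    m + D                   ≤⟨ ℕ.n≤1+n _ ⟩
    suc (m + D)             ∎

  spike-separates : ∀ {m} D (x y : Vec Bool m) → x ≢ y → D ≤ sumDiff x y (spike D x y)
  spike-separates D [] [] x≢y = contradiction refl x≢y
  spike-separates D (false ∷ x) (false ∷ y) x≢y =
    ℕ.≤-trans (spike-separates D x y (x≢y ∘ cong (false ∷_))) (ℕ.m≤n+m _ _)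
  spike-separates D (true ∷ x) (true ∷ y) x≢y =
    ℕ.≤-trans (spike-separates D x y (x≢y ∘ cong (true ∷_))) (ℕ.m≤n+m _ _)
  spike-separates D (false ∷ x) (true ∷ y)  x≢y = ℕ.m≤m+n D _
  spike-separates D (true ∷ x)  (false ∷ y) x≢y = ℕ.m≤m+n D _

  module _ {n k : ℕ} (D : ℕ) (K : Code n k (2 * D)) where
    open Code K
    open DecMembership (Vec.≡-dec {n = n} Bool._≟_) using () renaming (_∈?_ to _∈ˡ?_)

    isWord : BoolFun n
    isWord x = does (x ∈ˡ? words)

    isWord-true : ∀ {x} → x ∈ˡ words → isWord x ≡ true
    isWord-true {x} = dec-true (x ∈ˡ? words)

    isWord-false : ∀ {x} → ¬ x ∈ˡ words → isWord x ≡ false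
    isWord-false {x} = dec-false (x ∈ˡ? words)

    isWord-true⁻ : ∀ {x} → isWord x ≡ true → x ∈ˡ words
    isWord-true⁻ {x} e with x ∈ˡ? words
    ... | yes p = p

    isWord-false⁻ : ∀ {x} → isWord x ≡ false → ¬ x ∈ˡ words
    isWord-false⁻ {x} e with x ∈ˡ? words
    ... | no ¬p = ¬p

    ∃-word : ∃[ y ] y ∈ˡ words
    -- The empty assignment is the whole cube and has size 0.
    ∃-word with hits (replicate n nothing) (λ i → inj₂ (Vec.lookup-replicate i nothing)) (∅≤ n)
      where
      ∅≤ : ∀ m → size (replicate m nothing) ≤ k
      ∅≤ zero    = z≤n
      ∅≤ (suc m) = ∅≤ m
    ... | y , _ , y∈ = y , y∈

    -- Codewords are at distance at least `2 * D` from each other, so at most one lies at distance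
    -- below `D`, and the choice of `near` is immaterial.
    nonWordWeight : Input n → Vec ℕ n
    nonWordWeight x with any? (λ y → hamming x y ℕ.<? D) words
    ... | yes near = spike D x (proj₁ (find near))
    ... | no  _    = replicate n 1

    nonWordWeight-All : ∀ {P : ℕ → Set} → P 1 → P D → ∀ x → Allⱽ P (nonWordWeight x)
    nonWordWeight-All p q x with any? (λ y → hamming x y ℕ.<? D) words
    ... | yes near = spike-All p q x (proj₁ (find near))
    ... | no  _    = replicate-All p n

    nonWordWeight-sum : ∀ x → sum (nonWordWeight x) ≤ n + D
    nonWordWeight-sum x with any? (λ y → hamming x y ℕ.<? D) words
    ... | yes near = spike-sum D x (proj₁ (find near))
    ... | no  _    = ℕ.≤-trans (ℕ.≤-reflexive (sum-ones n)) (ℕ.m≤m+n n D)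

    module _ (1≤D : 1 ≤ D) where

      -- By `hits`, a small subcube through the zero word contains a codeword, which refutes a
      -- 0-certificate. The zero word is itself no codeword, since `nonzero` would put it at
      -- positive distance from itself.
      isWord-hard : HardZero isWord k
      isWord-hard = record
        { input = zeros n
        ; zero₀ = isWord-false λ 0∈ → ℕ.<⇒≱ (ℕ.<-≤-trans 1≤D (ℕ.m≤m+n D (D + 0)))
            (subst (2 * D ≤_) (hamming-refl (zeros n)) (All.lookup nonzero 0∈))
        ; hard  = hard
        }
        where
        hard : ∀ A → zeros n ∈ A → IsCertificate isWord false A → k ≤ size A
        hard A 0∈A cert with ℕ.≤-total k (size A)
        ... | inj₁ k≤ = k≤
        ... | inj₂ ≤k with hits A 0∈A ≤k
        ... | y , y∈A , y∈words = contradiction y∈words (isWord-false⁻ (cert y y∈A))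

      flip-word : ∀ {y} → y ∈ˡ words → ∀ i → isWord (flipBit y i) ≡ false
      flip-word {y} y∈ i = isWord-false λ y′∈ → case (distance y∈ y′∈)
        where
        case : ¬ (y ≡ flipBit y i ⊎ Far (2 * D) y (flipBit y i))
        case (inj₁ e)
          with () ← trans (sym (hamming-refl y)) (trans (cong (hamming y) e) (hamming-flip y i))
        case (inj₂ far) = ℕ.<⇒≱ (ℕ.*-monoʳ-≤ 2 1≤D) (subst (2 * D ≤_) (hamming-flip y i) far)

      -- Without a near codeword, `z` differs from `x` in at least `D` places of weight 1. If `z` is
      -- the near codeword, the spike gives `D`. Otherwise the triangle inequality through the near
      -- codeword keeps `z` at distance at least `D`.
      nonWordWeight-separates : ∀ {x z} → ¬ x ∈ˡ words → z ∈ˡ words → D ≤ sumDiff x z (nonWordWeight x)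
      nonWordWeight-separates {x} {z} x∉ z∈ with any? (λ y → hamming x y ℕ.<? D) words
      ... | no ¬near = ℕ.≮⇒≥ λ lt → ¬near (lose z∈ lt)
      ... | yes near with find near
      ... | y , y∈ , xy<D with distance y∈ z∈
      ... | inj₁ refl = spike-separates D x y λ { refl → x∉ y∈ }
      ... | inj₂ far  = ℕ.≤-trans (ℕ.+-cancelˡ-≤ D _ _ D+D≤)
        (hamming≤sumDiff x z (spike-All (ℕ.≤-refl {1}) 1≤D x y))
        where
        D+D≤ : D + D ≤ D + hamming x z
        D+D≤ = begin
          D + D                       ≡⟨ cong (D +_) (sym (ℕ.+-identityʳ D)) ⟩
          2 * D                       ≤⟨ far ⟩
          hamming y z                 ≤⟨ hamming-triangle y x z ⟩
          hamming y x + hamming x z   ≡⟨ cong (_+ hamming x z) (sumDiff-sym y x _) ⟩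
          hamming x y + hamming x z   ≤⟨ ℕ.+-monoˡ-≤ (hamming x z) (ℕ.<⇒≤ xy<D) ⟩
          D + hamming x z             ∎

      -- A codeword has weight `D` everywhere, so one factor `D` comes out of the product sum, and
      -- `nonWordWeight-separates` supplies the other.
      isWord-weighting : Weighting D isWord (n + D) (n * D)
      isWord-weighting = record
        { weight    = weight
        ; bounded   = bounded
        ; separated = separated
        ; sum₀      = sum₀
        ; sum₁      = sum₁
        }
        where
        weight : Input n → Vec ℕ n
        weight x = if isWord x then replicate n D else nonWordWeight x
        bounded : ∀ x → Allⱽ (_≤ D) (weight x)
        bounded x with isWord x
        ... | true  = replicate-All ℕ.≤-refl n
        ... | false = nonWordWeight-All 1≤D ℕ.≤-refl x
        sum₀ : ∀ x → isWord x ≡ false → sum (weight x) ≤ n + D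
        sum₀ x e rewrite e = nonWordWeight-sum x
        sum₁ : ∀ x → isWord x ≡ true → sum (weight x) ≤ n * D
        sum₁ x e rewrite e = ℕ.≤-reflexive (sum-replicate n D)
        separated : ∀ x y → isWord x ≡ true → isWord y ≡ false →
          D * D ≤ sumDiff x y (zipWith _*_ (weight x) (weight y))
        separated x y ex ey rewrite ex | ey = begin
          D * D                                     ≤⟨ ℕ.*-monoʳ-≤ D (nonWordWeight-separates {y} {x}
                                                         (isWord-false⁻ ey) (isWord-true⁻ ex)) ⟩
          D * sumDiff y x u                         ≡⟨ cong (D *_) (sumDiff-sym y x u) ⟩
          D * sumDiff x y u                         ≡⟨ sumDiff-scale D x y u ⟨
          sumDiff x y (Vec.map (D *_) u)            ≡⟨ cong (sumDiff x y) (Vec.zipWith-replicate₁ _*_ D u) ⟨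
          sumDiff x y (zipWith _*_ (replicate n D) u) ∎
          where
          u : Vec ℕ n
          u = nonWordWeight y

  -- OR of many blocks.

  module _ {n : ℕ} (g : BoolFun n) (r : ℕ) where

    rowsLength : ℕ → ℕ
    rowsLength zero    = r
    rowsLength (suc a) = n + rowsLength a

    -- The constant `false` on `r` further bits is padding, used to reach a prescribed input length.
    someRow : ∀ a → BoolFun (rowsLength a)
    someRow zero    = λ _ → false
    someRow (suc a) = g ∨ᶠ someRow a

    rowsLength≡ : ∀ a → rowsLength a ≡ a * n + r
    rowsLength≡ zero    = refl
    rowsLength≡ (suc a) = trans (cong (n +_) (rowsLength≡ a)) (sym (ℕ.+-assoc n (a * n) r))

    someRow-hard : ∀ {k} → HardZero g k → ∀ a → HardZero (someRow a) (a * k)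
    someRow-hard h zero    = record { input = replicate r false ; zero₀ = refl ; hard = λ _ _ _ → z≤n }
    someRow-hard h (suc a) = ∨-hard h (someRow-hard h a)

    someRow-weighting : ∀ {D s t} → Weighting D g s t → ∀ a → Weighting D (someRow a) (a * s) t
    someRow-weighting w zero = record
      { weight    = λ _ → replicate r 0
      ; bounded   = λ _ → replicate-All z≤n r
      ; separated = λ _ _ ()
      ; sum₀      = λ _ _ → ℕ.≤-reflexive (sum-zeros r)
      ; sum₁      = λ _ ()
      }
    someRow-weighting w (suc a) = ∨-weighting w (someRow-weighting w a)

open Combinatorics
open import Defs
open import Data.Integer using (+_)

-- Arithmetic of fractions with natural numerators.

-- frac d k is k / (d + 1).
frac : ℕ → ℕ → ℚ
frac d k = fromℚᵘ (mkℚᵘ (+ k) d)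

frac-mono : ∀ d e a b → a ℕ.* suc e ℕ.≤ b ℕ.* suc d → frac d a ℚ.≤ frac e b
frac-mono d e a b a≤b = ℚ.toℚᵘ-cancel-≤ (begin
  toℚᵘ (frac d a)   ≃⟨ ℚ.toℚᵘ-fromℚᵘ (mkℚᵘ (+ a) d) ⟩
  mkℚᵘ (+ a) d      ≤⟨ ℚᵘ.*≤* (subst₂ ℤ._≤_ (ℤ.pos-* a (suc e)) (ℤ.pos-* b (suc d)) (ℤ.+≤+ a≤b)) ⟩
  mkℚᵘ (+ b) e      ≃⟨ ℚ.toℚᵘ-fromℚᵘ (mkℚᵘ (+ b) e) ⟨
  toℚᵘ (frac e b)   ∎)
  where open ℚᵘ.≤-Reasoning

frac-cong : ∀ d e a b → a ℕ.* suc e ≡ b ℕ.* suc d → frac d a ≡ frac e b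
frac-cong d e a b a≡b = ℚ.≤-antisym
  (frac-mono d e a b (ℕ.≤-reflexive a≡b)) (frac-mono e d b a (ℕ.≤-reflexive (sym a≡b)))

-- The new index is the product `suc d * suc e` less one, because `frac` stores the predecessor of
-- the denominator.
frac-* : ∀ d e a b → frac d a ℚ.* frac e b ≡ frac (e ℕ.+ d ℕ.* suc e) (a ℕ.* b)
frac-* d e a b = ℚ.toℚᵘ-injective (begin-equality
  toℚᵘ (frac d a ℚ.* frac e b)                  ≃⟨ ℚ.toℚᵘ-homo-* (frac d a) (frac e b) ⟩
  toℚᵘ (frac d a) ℚᵘ.* toℚᵘ (frac e b)
    ≃⟨ ℚᵘ.*-cong (ℚ.toℚᵘ-fromℚᵘ (mkℚᵘ (+ a) d)) (ℚ.toℚᵘ-fromℚᵘ (mkℚᵘ (+ b) e)) ⟩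
  mkℚᵘ (+ a ℤ.* + b) (e ℕ.+ d ℕ.* suc e)        ≡⟨ cong (λ z → mkℚᵘ z (e ℕ.+ d ℕ.* suc e)) (ℤ.pos-* a b) ⟨
  mkℚᵘ (+ (a ℕ.* b)) (e ℕ.+ d ℕ.* suc e)        ≃⟨ ℚ.toℚᵘ-fromℚᵘ (mkℚᵘ (+ (a ℕ.* b)) _) ⟨
  toℚᵘ (frac (e ℕ.+ d ℕ.* suc e) (a ℕ.* b))     ∎)
  where open ℚᵘ.≤-Reasoning

frac-+ : ∀ d a b → frac d a ℚ.+ frac d b ≡ frac d (a ℕ.+ b)
frac-+ d a b = trans (ℚ.toℚᵘ-injective (begin-equality
  toℚᵘ (frac d a ℚ.+ frac d b)              ≃⟨ ℚ.toℚᵘ-homo-+ (frac d a) (frac d b) ⟩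
  toℚᵘ (frac d a) ℚᵘ.+ toℚᵘ (frac d b)
    ≃⟨ ℚᵘ.+-cong (ℚ.toℚᵘ-fromℚᵘ (mkℚᵘ (+ a) d)) (ℚ.toℚᵘ-fromℚᵘ (mkℚᵘ (+ b) d)) ⟩
  mkℚᵘ (+ a ℤ.* + suc d ℤ.+ + b ℤ.* + suc d) e
    ≡⟨ cong (λ z → mkℚᵘ z e) (cong₂ ℤ._+_ (ℤ.pos-* a (suc d)) (ℤ.pos-* b (suc d))) ⟨
  mkℚᵘ (+ (a ℕ.* suc d ℕ.+ b ℕ.* suc d)) e  ≃⟨ ℚ.toℚᵘ-fromℚᵘ (mkℚᵘ (+ (a ℕ.* suc d ℕ.+ b ℕ.* suc d)) e) ⟨
  toℚᵘ (frac e (a ℕ.* suc d ℕ.+ b ℕ.* suc d)) ∎))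
  (frac-cong e d (a ℕ.* suc d ℕ.+ b ℕ.* suc d) (a ℕ.+ b) (common a b (suc d)))
  where
  open ℚᵘ.≤-Reasoning
  e : ℕ
  e = d ℕ.+ d ℕ.* suc d
  common : ∀ a b D → (a ℕ.* D ℕ.+ b ℕ.* D) ℕ.* D ≡ (a ℕ.+ b) ℕ.* (D ℕ.* D)
  common = solve-∀

frac-0 : ∀ d → 0ℚ ≡ frac d 0
frac-0 d = frac-cong 0 d 0 0 refl

-- Order on the reals.

half-pos : ∀ {ε} → 0ℚ ℚ.< ε → 0ℚ ℚ.< ½ ℚ.* ε
half-pos {ε} 0<ε = ℚ.positive⁻¹ (½ ℚ.* ε) {{ℚ.pos*pos⇒pos ½ ε {{ℚ.positive 0<ε}}}}

pointwise⇒≤ : ∀ {x y} → (∀ t → seq x t ℚ.≤ seq y t) → x ≤ y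
pointwise⇒≤ {x} {y} x≤y ε 0<ε = 0 , λ t _ → begin
  seq x t           ≤⟨ x≤y t ⟩
  seq y t           ≡⟨ ℚ.+-identityʳ (seq y t) ⟨
  seq y t ℚ.+ 0ℚ    ≤⟨ ℚ.+-monoʳ-≤ (seq y t) (ℚ.<⇒≤ 0<ε) ⟩
  seq y t ℚ.+ ε     ∎
  where open ℚ.≤-Reasoning

+-mono-≤ : ∀ {x y u v} → x ≤ y → u ≤ v → x + u ≤ y + v
+-mono-≤ {x} {y} {u} {v} x≤y u≤v ε 0<ε
  with x≤y (½ ℚ.* ε) (half-pos 0<ε) | u≤v (½ ℚ.* ε) (half-pos 0<ε)
... | M , h | N , k = M ℕ.⊔ N , λ t t≥ → begin
  seq x t ℚ.+ seq u t
    ≤⟨ ℚ.+-mono-≤ (h t (ℕ.m⊔n≤o⇒m≤o M N t≥)) (k t (ℕ.m⊔n≤o⇒n≤o M N t≥)) ⟩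
  (seq y t ℚ.+ ½ ℚ.* ε) ℚ.+ (seq v t ℚ.+ ½ ℚ.* ε)
    ≡⟨ regroup (seq y t) (seq v t) ε ⟩
  seq y t ℚ.+ seq v t ℚ.+ ε ∎
  where
  open ℚ.≤-Reasoning
  regroup : ∀ p q ε → (p ℚ.+ ½ ℚ.* ε) ℚ.+ (q ℚ.+ ½ ℚ.* ε) ≡ p ℚ.+ q ℚ.+ ε
  regroup = solve 3 (λ p q ε → (p :+ con ½ :* ε) :+ (q :+ con ½ :* ε) := p :+ q :+ ε) refl
    where open ℚ.+-*-Solver

≤-trans : ∀ {x y z} → x ≤ y → y ≤ z → x ≤ z
≤-trans {x} {y} {z} x≤y y≤z ε 0<ε
  with x≤y (½ ℚ.* ε) (half-pos 0<ε) | y≤z (½ ℚ.* ε) (half-pos 0<ε)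
... | M , h | N , k = M ℕ.⊔ N , λ t t≥ → begin
  seq x t                             ≤⟨ h t (ℕ.m⊔n≤o⇒m≤o M N t≥) ⟩
  seq y t ℚ.+ ½ ℚ.* ε                 ≤⟨ ℚ.+-monoˡ-≤ (½ ℚ.* ε) (k t (ℕ.m⊔n≤o⇒n≤o M N t≥)) ⟩
  seq z t ℚ.+ ½ ℚ.* ε ℚ.+ ½ ℚ.* ε     ≡⟨ regroup (seq z t) ε ⟩
  seq z t ℚ.+ ε                       ∎
  where
  open ℚ.≤-Reasoning
  regroup : ∀ p ε → p ℚ.+ ½ ℚ.* ε ℚ.+ ½ ℚ.* ε ≡ p ℚ.+ ε
  regroup = solve 2 (λ p ε → p :+ con ½ :* ε :+ con ½ :* ε := p :+ ε) refl
    where open ℚ.+-*-Solver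

-- Two factors in the unit interval with product at least 1.

private
  ≤⇒0≤- : ∀ {p q} → p ℚ.≤ q → 0ℚ ℚ.≤ q ℚ.- p
  ≤⇒0≤- {p} {q} p≤q = subst (ℚ._≤ q ℚ.- p) (ℚ.+-inverseʳ p) (ℚ.+-monoˡ-≤ (ℚ.- p) p≤q)

  0≤-+ : ∀ {p q} → 0ℚ ℚ.≤ p → 0ℚ ℚ.≤ q → 0ℚ ℚ.≤ p ℚ.+ q
  0≤-+ = ℚ.+-mono-≤

  0≤-* : ∀ {p q} → 0ℚ ℚ.≤ p → 0ℚ ℚ.≤ q → 0ℚ ℚ.≤ p ℚ.* q
  0≤-* {p} {q} 0≤p 0≤q = subst (ℚ._≤ p ℚ.* q) (ℚ.*-zeroʳ p)
    (ℚ.*-monoˡ-≤-nonNeg p {{ℚ.nonNegative 0≤p}} 0≤q)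

  sixth : ℚ
  sixth = + 1 ℚ./ 6

  -- Exactly, 1 ≤ ab ≤ a because a(1 - b) ≥ 0. Cauchy sequences satisfy these inequalities only up
  -- to δ, and this version tracks the error.
  approximate-factor : ∀ a b δ → 0ℚ ℚ.≤ δ → δ ℚ.≤ 1ℚ →
    0ℚ ℚ.≤ a ℚ.+ δ → a ℚ.≤ 1ℚ ℚ.+ δ → 0ℚ ℚ.≤ b ℚ.+ δ → b ℚ.≤ 1ℚ ℚ.+ δ →
    1ℚ ℚ.≤ a ℚ.* b ℚ.+ δ → 1ℚ ℚ.≤ a ℚ.+ (+ 6 ℚ./ 1) ℚ.* δ
  approximate-factor a b δ 0≤δ δ≤1 0≤a a≤1 0≤b b≤1 1≤ab = begin
    1ℚ                ≡⟨ ℚ.+-identityʳ 1ℚ ⟨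
    1ℚ ℚ.+ 0ℚ         ≤⟨ ℚ.+-monoʳ-≤ 1ℚ (0≤-+ (0≤-+ (0≤-* 0≤a (≤⇒0≤- b≤1)) (≤⇒0≤- 1≤ab))
                          (0≤-* 0≤δ (0≤-+ (0≤-+ (≤⇒0≤- a≤1) 0≤b) (0≤-+ (≤⇒0≤- δ≤1) (≤⇒0≤- δ≤1))))) ⟩
    -- The added terms are nonnegative: the product is the perturbed a(1 - b), the next term is the
    -- slack of the product bound, and the multiple of δ is chosen to cancel the remaining terms in
    -- `a` and `b`.
    1ℚ ℚ.+ ((a ℚ.+ δ) ℚ.* (1ℚ ℚ.+ δ ℚ.- b) ℚ.+ (a ℚ.* b ℚ.+ δ ℚ.- 1ℚ)
      ℚ.+ δ ℚ.* ((1ℚ ℚ.+ δ ℚ.- a) ℚ.+ (b ℚ.+ δ) ℚ.+ ((1ℚ ℚ.- δ) ℚ.+ (1ℚ ℚ.- δ))))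
                      ≡⟨ identity a b δ ⟩
    a ℚ.+ δ ℚ.* (+ 5 ℚ./ 1 ℚ.+ δ)
                      ≤⟨ ℚ.+-monoʳ-≤ a (ℚ.*-monoˡ-≤-nonNeg δ {{ℚ.nonNegative 0≤δ}}
                           (ℚ.+-monoʳ-≤ (+ 5 ℚ./ 1) δ≤1)) ⟩
    a ℚ.+ δ ℚ.* (+ 6 ℚ./ 1)
                      ≡⟨ cong (a ℚ.+_) (ℚ.*-comm δ (+ 6 ℚ./ 1)) ⟩
    a ℚ.+ (+ 6 ℚ./ 1) ℚ.* δ ∎
    where
    open ℚ.≤-Reasoning
    identity : ∀ a b δ → 1ℚ ℚ.+ ((a ℚ.+ δ) ℚ.* (1ℚ ℚ.+ δ ℚ.- b) ℚ.+ (a ℚ.* b ℚ.+ δ ℚ.- 1ℚ)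
      ℚ.+ δ ℚ.* ((1ℚ ℚ.+ δ ℚ.- a) ℚ.+ (b ℚ.+ δ) ℚ.+ ((1ℚ ℚ.- δ) ℚ.+ (1ℚ ℚ.- δ))))
        ≡ a ℚ.+ δ ℚ.* (+ 5 ℚ./ 1 ℚ.+ δ)
    identity = solve 3 (λ a b δ → con 1ℚ :+ ((a :+ δ) :* (con 1ℚ :+ δ :- b) :+ (a :* b :+ δ :- con 1ℚ)
      :+ δ :* ((con 1ℚ :+ δ :- a) :+ (b :+ δ) :+ ((con 1ℚ :- δ) :+ (con 1ℚ :- δ))))
        := a :+ δ :* (con (+ 5 ℚ./ 1) :+ δ)) refl
      where open ℚ.+-*-Solver

  tolerance : ∀ {ε} → 0ℚ ℚ.< ε → ∃[ δ ] (0ℚ ℚ.< δ × δ ℚ.≤ 1ℚ × (+ 6 ℚ./ 1) ℚ.* δ ℚ.≤ ε)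
  tolerance {ε} 0<ε = δ , 0<δ , δ≤1 , 6δ≤ε
    where
    open ℚ.≤-Reasoning
    ε′ : ℚ
    -- The cap at 1 ensures δ ≤ 1, by which `approximate-factor` bounds 5 + δ by 6.
    ε′ = ε ℚ.⊓ 1ℚ
    0<ε′ : 0ℚ ℚ.< ε′
    0<ε′ with ℚ.⊓-sel ε 1ℚ
    ... | inj₁ e = subst (0ℚ ℚ.<_) (sym e) 0<ε
    ... | inj₂ e = subst (0ℚ ℚ.<_) (sym e) (ℚ.positive⁻¹ 1ℚ)
    δ : ℚ
    δ = sixth ℚ.* ε′
    0<δ : 0ℚ ℚ.< δ
    0<δ = ℚ.positive⁻¹ δ {{ℚ.pos*pos⇒pos sixth ε′ {{ℚ.positive 0<ε′}}}}
    δ≤1 : δ ℚ.≤ 1ℚ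
    δ≤1 = begin
      sixth ℚ.* ε′  ≤⟨ ℚ.*-monoˡ-≤-nonNeg sixth (ℚ.p⊓q≤q ε 1ℚ) ⟩
      sixth ℚ.* 1ℚ  ≤⟨ ℚ.≤ᵇ⇒≤ _ ⟩
      1ℚ            ∎
    6δ≤ε : (+ 6 ℚ./ 1) ℚ.* δ ℚ.≤ ε
    6δ≤ε = begin
      (+ 6 ℚ./ 1) ℚ.* (sixth ℚ.* ε′)  ≡⟨ ℚ.*-assoc (+ 6 ℚ./ 1) sixth ε′ ⟨
      1ℚ ℚ.* ε′                       ≡⟨ ℚ.*-identityˡ ε′ ⟩
      ε′                              ≤⟨ ℚ.p⊓q≤p ε 1ℚ ⟩
      ε                               ∎

1≤*⇒1≤ : ∀ {a b} → 0ℝ ≤ a → a ≤ 1ℝ → 0ℝ ≤ b → b ≤ 1ℝ → 1ℝ ≤ a * b → 1ℝ ≤ a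
1≤*⇒1≤ {a} {b} 0≤a a≤1 0≤b b≤1 1≤ab ε 0<ε with tolerance 0<ε
... | δ , 0<δ , δ≤1 , 6δ≤ε with 0≤a δ 0<δ | a≤1 δ 0<δ | 0≤b δ 0<δ | b≤1 δ 0<δ | 1≤ab δ 0<δ
... | N₁ , h₁ | N₂ , h₂ | N₃ , h₃ | N₄ , h₄ | N₅ , h₅ =
  N₁ ℕ.⊔ (N₂ ℕ.⊔ (N₃ ℕ.⊔ (N₄ ℕ.⊔ N₅))) , λ t t≥ → let
    t≥₂ = ℕ.m⊔n≤o⇒n≤o N₁ _ t≥
    t≥₃ = ℕ.m⊔n≤o⇒n≤o N₂ _ t≥₂
    t≥₄ = ℕ.m⊔n≤o⇒n≤o N₃ _ t≥₃
    in ℚ.≤-trans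
      (approximate-factor (seq a t) (seq b t) δ (ℚ.<⇒≤ 0<δ) δ≤1
        (h₁ t (ℕ.m⊔n≤o⇒m≤o N₁ _ t≥)) (h₂ t (ℕ.m⊔n≤o⇒m≤o N₂ _ t≥₂))
        (h₃ t (ℕ.m⊔n≤o⇒m≤o N₃ _ t≥₃)) (h₄ t (ℕ.m⊔n≤o⇒m≤o N₄ N₅ t≥₄))
        (h₅ t (ℕ.m⊔n≤o⇒n≤o N₄ N₅ t≥₄)))
      (ℚ.+-monoʳ-≤ (seq a t) 6δ≤ε)

-- Lower bound on the objective from sensitive coordinates.

≤-maxOverInputs : ∀ {N} (g : Input N → ℝ) x → g x ≤ maxOverInputs g
≤-maxOverInputs g x = pointwise⇒≤ {g x} {maxOverInputs g} λ t → below g x t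
  where
  below : ∀ {N} (g : Input N → ℝ) x t → seq (g x) t ℚ.≤ seq (maxOverInputs g) t
  below g []          t = ℚ.≤-refl
  below g (false ∷ x) t = ℚ.≤-trans (below (g ∘ (false ∷_)) x t)
    (ℚ.p≤p⊔q (seq (maxOverInputs (g ∘ (false ∷_))) t) _)
  below g (true ∷ x)  t = ℚ.≤-trans (below (g ∘ (true ∷_)) x t)
    (ℚ.p≤q⊔p (seq (maxOverInputs (g ∘ (false ∷_))) t) _)

maxOverInputs-lub : ∀ {N} (g : Input N → ℝ) t {q} → (∀ x → seq (g x) t ℚ.≤ q) →
  seq (maxOverInputs g) t ℚ.≤ q
maxOverInputs-lub {zero}  g t g≤q = g≤q []
maxOverInputs-lub {suc N} g t g≤q = ℚ.⊔-lub
  (maxOverInputs-lub (g ∘ (false ∷_)) t (g≤q ∘ (false ∷_)))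
  (maxOverInputs-lub (g ∘ (true ∷_)) t (g≤q ∘ (true ∷_)))

∑-nonneg : ∀ {k} (u : Fin k → ℝ) → (∀ i → 0ℝ ≤ u i) → 0ℝ ≤ ∑ u
∑-nonneg {zero}  u 0≤u = pointwise⇒≤ {0ℝ} {0ℝ} λ _ → ℚ.≤-refl
∑-nonneg {suc k} u 0≤u =
  +-mono-≤ {0ℝ} {u zero} {0ℝ} {∑ (u ∘ suc)} (0≤u zero) (∑-nonneg (u ∘ suc) (0≤u ∘ suc))

-- Only the first `m` coordinates will be known to be sensitive; the remaining ones contribute at
-- least 0.
∑-ones : ∀ m {k} (u : Fin (m ℕ.+ k) → ℝ) → (∀ i → 1ℝ ≤ u (i ↑ˡ k)) → (∀ i → 0ℝ ≤ u i) →
  fromℕ m ≤ ∑ u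
∑-ones zero    u 1≤u 0≤u = ∑-nonneg u 0≤u
∑-ones (suc m) u 1≤u 0≤u = ≤-trans {fromℕ (suc m)} {1ℝ + fromℕ m} {∑ u}
  (pointwise⇒≤ {fromℕ (suc m)} {1ℝ + fromℕ m} λ _ → ℚ.≤-reflexive (sym (frac-+ 0 1 m)))
  (+-mono-≤ {1ℝ} {u zero} {fromℕ m} {∑ (u ∘ suc)} (1≤u zero)
    (∑-ones m (u ∘ suc) (1≤u ∘ suc) (0≤u ∘ suc)))

-- The two inputs differ at `i` alone, so every other summand is 0. The equality is termwise, since
-- equal reals need not be propositionally equal.
separation-flip : ∀ {N} (x : Input N) i (u : Fin N → ℝ) t →
  seq (∑ λ j → if ⌊ lookup x j Bool.≟ lookup (flipBit x i) j ⌋ then 0ℝ else u j) t ≡ seq (u i) t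
separation-flip (a ∷ x) zero u t = trans
  (cong₂ ℚ._+_ (head a) (same x (u ∘ suc))) (ℚ.+-identityʳ (seq (u zero) t))
  where
  head : ∀ a → seq (if ⌊ a Bool.≟ not a ⌋ then 0ℝ else u zero) t ≡ seq (u zero) t
  head false = refl
  head true  = refl
  same : ∀ {M} (x : Input M) (v : Fin M → ℝ) →
    seq (∑ λ j → if ⌊ lookup x j Bool.≟ lookup x j ⌋ then 0ℝ else v j) t ≡ 0ℚ
  same []          v = refl
  same (false ∷ x) v = trans (ℚ.+-identityˡ _) (same x (v ∘ suc))
  same (true  ∷ x) v = trans (ℚ.+-identityˡ _) (same x (v ∘ suc))
separation-flip (false ∷ x) (suc i) u t = trans (ℚ.+-identityˡ _) (separation-flip x i (u ∘ suc) t)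
separation-flip (true  ∷ x) (suc i) u t = trans (ℚ.+-identityˡ _) (separation-flip x i (u ∘ suc) t)

-- At a sensitive coordinate i feasibility forces 1 ≤ w x i.
sensitive⇒≤objective : ∀ m {k} {f : BoolFun (m ℕ.+ k)} x → (∀ i → f x ≢ f (flipBit x (i ↑ˡ k))) →
  ∀ w → Feasible f w → fromℕ m ≤ objective w
sensitive⇒≤objective m {k} {f} x sensitive w feasible =
  ≤-trans {fromℕ m} {∑ (w x)} {objective w}
    (∑-ones m (w x) weight-1 (nonneg x))
    (≤-maxOverInputs (λ x → ∑ (w x)) x)
  where
  open Feasible feasible
  weight-1 : ∀ i → 1ℝ ≤ w x (i ↑ˡ k)
  weight-1 i = 1≤*⇒1≤ {w x j} {w y j} (nonneg x j) (≤one x j) (nonneg y j) (≤one y j)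
    (≤-trans {1ℝ} {separation w x y} {w x j * w y j} (separates x y (sensitive i))
      (pointwise⇒≤ {separation w x y} {w x j * w y j} λ t →
        ℚ.≤-reflexive (separation-flip x j (λ i → w x i * w y i) t)))
    where
    j : Fin (m ℕ.+ k)
    j = i ↑ˡ k
    y : Input (m ℕ.+ k)
    y = flipBit x j

-- From discrete weightings to feasible real families.

module _ (n : ℕ) {d N s₀ s₁ : ℕ} {f : BoolFun N} (W : Weighting (suc d) f s₀ s₁)
         (s₀≤ : s₀ ℕ.≤ n ℕ.* suc d) (s₁≤ : s₁ ℕ.≤ n ℕ.* suc d) where
  open Weighting W

  realWeight : Weights N
  realWeight x i = fromℚ (frac d (lookup (weight x) i))

  private
    e : ℕ
    e = d ℕ.+ d ℕ.* suc d

  ∑-frac : ∀ {M} (u : Vec ℕ M) t → seq (∑ λ i → fromℚ (frac d (lookup u i))) t ≡ frac d (sum u)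
  ∑-frac []      t = frac-0 d
  ∑-frac (k ∷ u) t = trans (cong (frac d k ℚ.+_) (∑-frac u t)) (frac-+ d k (sum u))

  separation-frac : ∀ {M} (x y : Input M) (u v : Vec ℕ M) t →
    seq (∑ λ i → if ⌊ lookup x i Bool.≟ lookup y i ⌋ then 0ℝ
                 else fromℚ (frac d (lookup u i)) * fromℚ (frac d (lookup v i))) t
      ≡ frac e (sumDiff x y (zipWith ℕ._*_ u v))
  separation-frac [] [] [] [] t = frac-0 e
  separation-frac (a ∷ x) (b ∷ y) (k ∷ u) (l ∷ v) t = trans
    (cong₂ ℚ._+_ head (separation-frac x y u v t))
    (frac-+ e (if ⌊ a Bool.≟ b ⌋ then 0 else k ℕ.* l) (sumDiff x y (zipWith ℕ._*_ u v)))
    where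
    head : seq (if ⌊ a Bool.≟ b ⌋ then 0ℝ else fromℚ (frac d k) * fromℚ (frac d l)) t
      ≡ frac e (if ⌊ a Bool.≟ b ⌋ then 0 else k ℕ.* l)
    head with ⌊ a Bool.≟ b ⌋
    ... | true  = frac-0 e
    ... | false = frac-* d d k l

  realWeight-feasible : Feasible f realWeight
  realWeight-feasible = record
    { separates = λ x y fx≢fy → pointwise⇒≤ {1ℝ} {separation realWeight x y} λ t →
        subst (1ℚ ℚ.≤_) (sym (separation-frac x y (weight x) (weight y) t))
          (frac-mono 0 e 1 (sumDiff x y (zipWith ℕ._*_ (weight x) (weight y)))
            (subst₂ ℕ._≤_ (sym (ℕ.*-identityˡ (suc e))) (sym (ℕ.*-identityʳ _)) (separated′ x y fx≢fy)))
    ; nonneg    = λ x i → pointwise⇒≤ {0ℝ} {realWeight x i} λ _ →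
        frac-mono 0 d 0 (lookup (weight x) i) z≤n
    ; ≤one      = λ x i → pointwise⇒≤ {realWeight x i} {1ℝ} λ _ →
        frac-mono d 0 (lookup (weight x) i) 1 (subst₂ ℕ._≤_ (sym (ℕ.*-identityʳ _)) (sym (ℕ.*-identityˡ _))
          (Allⱽ.lookup⁺ (bounded x) i))
    }
    where
    -- `suc e` is the square of `suc d`. A `Weighting` separates 1-inputs from 0-inputs in that
    -- order only; the reverse order follows by symmetry of `sumDiff` and of the product.
    separated′ : ∀ x y → f x ≢ f y → suc e ℕ.≤ sumDiff x y (zipWith ℕ._*_ (weight x) (weight y))
    separated′ x y fx≢fy with f x in fx | f y in fy
    ... | false | false = contradiction refl fx≢fy
    ... | true  | true  = contradiction refl fx≢fy
    ... | true  | false = separated x y fx fy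
    ... | false | true  = subst (suc e ℕ.≤_)
      (trans (sumDiff-sym y x _) (cong (sumDiff x y) (Vec.zipWith-comm ℕ.*-comm (weight y) (weight x))))
      (separated y x fy fx)

  realWeight-objective : ∀ t → seq (objective realWeight) t ℚ.≤ frac 0 n
  realWeight-objective t = maxOverInputs-lub (λ x → ∑ (realWeight x)) t λ x →
    subst (ℚ._≤ frac 0 n) (sym (∑-frac (weight x) t))
      (frac-mono d 0 (sum (weight x)) n (subst (ℕ._≤ n ℕ.* suc d) (sym (ℕ.*-identityʳ _)) (total x)))
    where
    total : ∀ x → sum (weight x) ℕ.≤ n ℕ.* suc d
    total x with f x in fx
    ... | false = ℕ.≤-trans (sum₀ x fx) s₀≤
    ... | true  = ℕ.≤-trans (sum₁ x fx) s₁≤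

  -- The objective of `realWeight` is at most `n`, so this single family serves every ε and the
  -- infimum is attained.
  weighting⇒IsEC : (∀ w → Feasible f w → fromℕ n ≤ objective w) → IsEC f (fromℕ n)
  weighting⇒IsEC lower = record
    { lowerBound = lower
    ; approached = λ ε 0<ε → realWeight , realWeight-feasible , approach ε 0<ε
    }
    where
    open ℚ.≤-Reasoning
    approach : ∀ ε → 0ℝ < ε → objective realWeight ≤ fromℕ n + ε
    approach ε (η , 0<η , M , η≤ε) δ 0<δ = M , λ t t≥ → begin
      seq (objective realWeight) t      ≤⟨ realWeight-objective t ⟩
      frac 0 n                          ≡⟨ ℚ.+-identityʳ (frac 0 n) ⟨
      frac 0 n ℚ.+ 0ℚ                   ≤⟨ ℚ.+-monoʳ-≤ (frac 0 n) (ℚ.<⇒≤ 0<η) ⟩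
      frac 0 n ℚ.+ η                    ≤⟨ ℚ.+-monoʳ-≤ (frac 0 n)
                                             (ℚ.≤-trans (ℚ.≤-reflexive (sym (ℚ.+-identityˡ η))) (η≤ε t t≥)) ⟩
      frac 0 n ℚ.+ seq ε t              ≡⟨ ℚ.+-identityʳ _ ⟨
      frac 0 n ℚ.+ seq ε t ℚ.+ 0ℚ       ≤⟨ ℚ.+-monoʳ-≤ (frac 0 n ℚ.+ seq ε t) (ℚ.<⇒≤ 0<δ) ⟩
      frac 0 n ℚ.+ seq ε t ℚ.+ δ        ∎

-- The lower bound for the OR and the choice of parameters.

flip-++ : ∀ {m k} (x : Input m) (y : Input k) i → flipBit (x ++ y) (i ↑ˡ k) ≡ flipBit x i ++ y
flip-++ (a ∷ x) y zero    = refl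
flip-++ (a ∷ x) y (suc i) = cong (a ∷_) (flip-++ x y i)

module _ {n k d : ℕ} (K : Code n k (2 ℕ.* suc d)) (r : ℕ) (a : ℕ) where

  private
    g : BoolFun n
    g = isWord (suc d) K
    f : BoolFun (rowsLength g r (suc a))
    f = someRow g r (suc a)

  -- The sensitive input has a codeword in the first block and the hard zero elsewhere, so any flip
  -- in the first block turns the OR to `false`. The block count `suc a` makes sure that there is a
  -- first block.
  someRow-≤objective : ∀ w → Feasible f w → fromℕ n ≤ objective w
  someRow-≤objective with ∃-word (suc d) K
  ... | y , y∈ = sensitive⇒≤objective n (y ++ z) λ i e →
    contradiction (trans (sym (value y (isWord-true (suc d) K y∈)))
      (trans e (trans (cong f (flip-++ y z i))
        (value (flipBit y i) (flip-word (suc d) K (s≤s z≤n) y∈ i))))) λ ()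
    where
    rest : HardZero (someRow g r a) (a ℕ.* k)
    rest = someRow-hard g r (isWord-hard (suc d) K (s≤s z≤n)) a
    z : Input (rowsLength g r a)
    z = HardZero.input rest
    value : ∀ x {b} → g x ≡ b → f (x ++ z) ≡ b
    value x {b} gx = trans (∨ᶠ-++ g (someRow g r a) x z)
      (trans (cong₂ _∨_ gx (HardZero.zero₀ rest)) (Bool.∨-identityʳ b))

-- n ≤ 42 D and n ≤ 86 a for D = ⌊n / 21⌋ and a = ⌊n / 43⌋, and 3612 = 42 · 86.
Quadratic : ℕ → ℕ → Set
Quadratic n N = Σ[ f ∈ BoolFun N ] (IsEC f (fromℕ n) × n ℕ.* n ℕ.≤ 3612 ℕ.* C f)

quadratic : ∀ n → 43 ℕ.≤ n → Quadratic n (n ℕ.* n)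
quadratic n 43≤n = from-parts (n ℕ./ 21) (n ℕ./ 43) refl refl
  (ℕ.m≥n⇒m/n>0 {n} {21} (ℕ.≤-trans (ℕ.≤ᵇ⇒≤ 21 43 _) 43≤n)) (ℕ.m≥n⇒m/n>0 {n} {43} 43≤n)
  where
  -- The quotients become variables here, so that both can be matched as successors.
  from-parts : ∀ D a → D ≡ n ℕ./ 21 → a ≡ n ℕ./ 43 → 1 ℕ.≤ D → 1 ℕ.≤ a → Quadratic n (n ℕ.* n)
  from-parts D@(suc d) a@(suc a′) D≡ a≡ 1≤D 1≤a = subst (Quadratic n) length≡
    ( someRow g r a
    , weighting⇒IsEC n (someRow-weighting g r (isWord-weighting D K 1≤D) a) total₀ ℕ.≤-refl
        (someRow-≤objective K r a′)
    , (begin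
        n ℕ.* n                   ≤⟨ ℕ.*-mono-≤ n≤42D n≤86a ⟩
        (42 ℕ.* D) ℕ.* (86 ℕ.* a) ≡⟨ product D a ⟩
        3612 ℕ.* (a ℕ.* D)        ≤⟨ ℕ.*-monoʳ-≤ 3612 (hard⇒≤C (someRow-hard g r (isWord-hard D K 1≤D) a)) ⟩
        3612 ℕ.* C (someRow g r a) ∎) )
    where
    open ℕ.≤-Reasoning
    product : ∀ D a → (42 ℕ.* D) ℕ.* (86 ℕ.* a) ≡ 3612 ℕ.* (a ℕ.* D)
    product = solve-∀
    double : ∀ q p → p ℕ.* q ℕ.+ p ℕ.* q ≡ 2 ℕ.* p ℕ.* q
    double = solve-∀
    n≡ : ∀ p .{{_ : ℕ.NonZero p}} q → q ≡ n ℕ./ p → q ℕ.* p ℕ.+ n ℕ.% p ≡ n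
    n≡ p q refl = trans (ℕ.+-comm (q ℕ.* p) (n ℕ.% p)) (sym (ℕ.m≡m%n+[m/n]*n n p))
    n≤2pq : ∀ p .{{_ : ℕ.NonZero p}} q → q ≡ n ℕ./ p → 1 ℕ.≤ q → n ℕ.≤ 2 ℕ.* p ℕ.* q
    n≤2pq p q q≡ 1≤q = begin
      n                     ≡⟨ n≡ p q q≡ ⟨
      q ℕ.* p ℕ.+ n ℕ.% p   ≤⟨ ℕ.+-mono-≤ (ℕ.≤-reflexive (ℕ.*-comm q p))
                                 (ℕ.≤-trans (ℕ.<⇒≤ (ℕ.m%n<n n p)) (ℕ.m≤m*n p q {{ℕ.>-nonZero 1≤q}})) ⟩
      p ℕ.* q ℕ.+ p ℕ.* q   ≡⟨ double q p ⟩
      2 ℕ.* p ℕ.* q         ∎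
    n≤42D : n ℕ.≤ 42 ℕ.* D
    n≤42D = n≤2pq 21 D D≡ 1≤D
    n≤86a : n ℕ.≤ 86 ℕ.* a
    n≤86a = n≤2pq 43 a a≡ 1≤a
    43a≤n : a ℕ.* 43 ℕ.≤ n
    43a≤n = ℕ.≤-trans (ℕ.m≤m+n (a ℕ.* 43) (n ℕ.% 43)) (ℕ.≤-reflexive (n≡ 43 a a≡))
    K : Code n D (2 ℕ.* D)
    K = code (subst (λ n → Sparse n D (2 ℕ.* D)) (n≡ 21 D D≡) (sparse-21 D (n ℕ.% 21)))
    g : BoolFun n
    g = isWord D K
    -- Padding up to length n²; the subtraction is exact because a ≤ n.
    r : ℕ
    r = n ℕ.* n ℕ.∸ a ℕ.* n
    length≡ : rowsLength g r a ≡ n ℕ.* n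
    length≡ = trans (rowsLength≡ g r a)
      (ℕ.m+[n∸m]≡n (ℕ.*-monoˡ-≤ n (ℕ.≤-trans (ℕ.m≤m*n a 43) 43a≤n)))
    -- The divisor 43 is 42 + 1: n + D ≤ 43 D, and 43 a ≤ n.
    total₀ : a ℕ.* (n ℕ.+ D) ℕ.≤ n ℕ.* D
    total₀ = begin
      a ℕ.* (n ℕ.+ D)          ≤⟨ ℕ.*-monoʳ-≤ a (ℕ.+-monoˡ-≤ D n≤42D) ⟩
      a ℕ.* (42 ℕ.* D ℕ.+ D)   ≡⟨ regroup a D ⟩
      a ℕ.* 43 ℕ.* D           ≤⟨ ℕ.*-monoˡ-≤ D 43a≤n ⟩
      n ℕ.* D                  ∎
      where
      regroup : ∀ a D → a ℕ.* (42 ℕ.* D ℕ.+ D) ≡ a ℕ.* 43 ℕ.* D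
      regroup = solve-∀

mainTheorem9 : ∃[ K ] ∃[ c ] ∃[ c′ ] (0ℝ < K) × (0ℝ < c) × (0ℝ < c′) ×
    (∃[ n₀ ] ((n : ℕ) → n₀ ℕ.≤ n →
    Σ[ f ∈ BoolFun (n ℕ.^ 2) ] ∃[ EC ]
    (IsEC f EC)
    × (EC ≤ K * fromℕ n)
    × (c * fromℕ (n ℕ.^ 2) ≤ fromℕ (C f))
    × (c′ * (EC * EC) ≤ fromℕ (C f))))
-- `K` is 1 because the optimum is exactly `n`, and for the same reason one constant 1/3612 serves
-- as both `c` and `c′`. The threshold 43 makes both ⌊n/21⌋ and ⌊n/43⌋ positive.
mainTheorem9 = 1ℝ , c , c , positive 1ℚ , positive (frac 3611 1) , positive (frac 3611 1) , 43 , λ n 43≤n →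
  let f , ec , n²≤ = subst (Quadratic n) (n*n≡n^2 n) (quadratic n 43≤n) in
  f , fromℕ n , ec
    , pointwise⇒≤ {fromℕ n} {1ℝ * fromℕ n} (λ _ → ℚ.≤-reflexive (sym (ℚ.*-identityˡ _)))
    , pointwise⇒≤ {c * fromℕ (n ℕ.^ 2)} {fromℕ (C f)}
        (λ _ → bound (n ℕ.^ 2) (C f) (subst (ℕ._≤ 3612 ℕ.* C f) (n*n≡n^2 n) n²≤))
    , pointwise⇒≤ {c * (fromℕ n * fromℕ n)} {fromℕ (C f)}
        (λ _ → ℚ.≤-trans (ℚ.≤-reflexive (cong (frac 3611 1 ℚ.*_) (frac-* 0 0 n n)))
          (bound (n ℕ.* n) (C f) n²≤))
  where
  c : ℝ
  c = fromℚ (frac 3611 1)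
  positive : ∀ q .{{_ : ℚ.Positive q}} → 0ℝ < fromℚ q
  positive q = q , ℚ.positive⁻¹ q , 0 , λ _ _ → ℚ.≤-reflexive (ℚ.+-identityˡ q)
  n*n≡n^2 : ∀ n → n ℕ.* n ≡ n ℕ.^ 2
  n*n≡n^2 n = cong (n ℕ.*_) (sym (ℕ.*-identityʳ n))
  bound : ∀ a b → a ℕ.≤ 3612 ℕ.* b → frac 3611 1 ℚ.* frac 0 a ℚ.≤ frac 0 b
  bound a b a≤ = subst (ℚ._≤ frac 0 b) (sym (frac-* 3611 0 1 a))
    (frac-mono 3611 0 (1 ℕ.* a) b
      (subst₂ ℕ._≤_ (sym (trans (ℕ.*-identityʳ (1 ℕ.* a)) (ℕ.*-identityˡ a))) (ℕ.*-comm 3612 b) a≤))
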